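{- Let $T=\{1324,1432,3142\}$. Then $$F_T(x)=\frac{1-x}{2-2x-(1-x-x^2)C(x)}.$$
   Context: $S_n(T)$ denotes the set of permutations $\pi$ of $[n]=\{1,\dots,n\}$ (one-line notation) that avoid every pattern $\tau\in T$, i.e. no subsequence of $\pi$ is order-isomorphic to $\tau$. $F_T(x)=\sum_{n\ge 0}|S_n(T)|x^n$, a formal power series, with $|S_0(T)|=1$. $C(x)=\frac{1-\sqrt{1-4x}}{2x}=\sum_{n\ge0}\frac{1}{n+1}\binom{2n}{n}x^n$ is the generating function of the Catalan numbers. -}

module Defs where

open import Data.Fin as Fin using (Fin; toℕ)
open import Data.Fin.Properties as Fin using (all?; any?)
open import Data.Integer as ℤ using ()
open import Data.List as List using (List; []; _∷_; length; filter; cartesianProductWith; allFin)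
open import Data.List.Membership.Propositional using (_∈_; lose)
open import Data.List.Membership.Propositional.Properties
  using (∈-allFin; ∈-cartesianProductWith⁺; ∈-filter⁺; ∈-filter⁻)
open import Data.List.Relation.Unary.All as All using (All)
open import Data.List.Relation.Unary.Any as Any using (here)
open import Data.List.Relation.Unary.Unique.Propositional using (Unique; []; _∷_)
open import Data.List.Relation.Unary.Unique.Propositional.Properties
  using (allFin⁺; cartesianProductWith⁺; filter⁺)
open import Data.Nat as ℕ using (ℕ; zero; suc; _∸_)
open import Data.Nat.Combinatorics renaming (_C_ to _choose_)
open import Data.Nat.Properties as ℕ using ()
open import Data.Product using (∃; _×_; _,_; proj₂)
open import Data.Rational as ℚ using (ℚ; 0ℚ; 1ℚ; 1/_)
open import Data.Rational.Properties as ℚ using ()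
open import Data.Vec as Vec using (Vec; []; _∷_; lookup)
open import Data.Vec.Properties using (∷-injective)
open import Function using (_∘_)
open import Function.Bundles using (_⇔_; mk⇔; Equivalence)
open import Function.Consequences.Propositional
  using (strictlySurjective⇒surjective; surjective⇒strictlySurjective)
open import Function.Definitions using (Bijective; Injective; Surjective)
open import Relation.Binary.PropositionalEquality
open import Relation.Nullary using (Dec; ¬_; ¬?; _×-dec_; _→-dec_)
open import Relation.Nullary.Decidable using (map′)

open import Algebra.Properties.CommutativeMonoid.Sum
  ℚ.+-0-commutativeMonoid using (sum-syntax; sum⁺-syntax; sum-cong-≗)

private
  variable
    k n : ℕ

-- A word of length k over an n-letter alphabet.  Letters run through
-- 0, …, n ∸ 1 instead of 1, …, n; pattern containment only depends on
-- their relative order.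
Word : ℕ → ℕ → Set
Word k n = Vec (Fin n) k

IsPermutation : Word n n → Set
IsPermutation π = Bijective _≡_ _≡_ (lookup π)

-- Patterns are written in one-line notation, e.g. 1 ∷ 3 ∷ 2 ∷ 4 ∷ [].
Pattern : Set
Pattern = List ℕ

Increasing : Word k n → Set
Increasing p = ∀ i j → i Fin.< j → lookup p i Fin.< lookup p j

-- The subsequence of π at the positions p is order-isomorphic to τ.
OrderIsomorphicAt : (τ : Pattern) → Word n n → Word (length τ) n → Set
OrderIsomorphicAt τ π p = ∀ i j →
  (List.lookup τ i ℕ.< List.lookup τ j) ⇔
  (lookup π (lookup p i) Fin.< lookup π (lookup p j))

Contains : Word n n → Pattern → Set
Contains {n} π τ = ∃ λ (p : Word (length τ) n) → Increasing p × OrderIsomorphicAt τ π p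

Avoids : Word n n → List Pattern → Set
Avoids π T = All (λ τ → ¬ Contains π τ) T

words : ∀ k n → List (Word k n)
words zero    n = [] ∷ []
words (suc k) n = cartesianProductWith _∷_ (allFin n) (words k n)

∈-words : (w : Word k n) → w ∈ words k n
∈-words []      = here refl
∈-words (x ∷ w) = ∈-cartesianProductWith⁺ _∷_ (∈-allFin x) (∈-words w)

words-unique : ∀ k n → Unique (words k n)
words-unique zero    n = All.[] ∷ []
words-unique (suc k) n =
  cartesianProductWith⁺ _∷_ ∷-injective (allFin⁺ n) (words-unique k n)

isPermutation? : (π : Word n n) → Dec (IsPermutation π)
isPermutation? π = injective? ×-dec surjective?
  where
  injective? : Dec (Injective _≡_ _≡_ (lookup π))
  injective? = map′ (λ f {i} {j} → f i j) (λ f i j → f)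
    (all? λ i → all? λ j → (lookup π i Fin.≟ lookup π j) →-dec (i Fin.≟ j))

  surjective? : Dec (Surjective _≡_ _≡_ (lookup π))
  surjective? = map′
    strictlySurjective⇒surjective surjective⇒strictlySurjective
    (all? λ y → any? λ i → lookup π i Fin.≟ y)

contains? : (π : Word n n) (τ : Pattern) → Dec (Contains π τ)
contains? {n} π τ =
  map′ Any.satisfied (λ (p , h) → lose (∈-words p) h)
    (Any.any? (λ p → increasing? p ×-dec orderIsomorphicAt? p) (words (length τ) n))
  where
  increasing? : (p : Word (length τ) n) → Dec (Increasing p)
  increasing? p = all? λ i → all? λ j →
    (i Fin.<? j) →-dec (lookup p i Fin.<? lookup p j)

  _⇔?_ : ∀ {A B : Set} → Dec A → Dec B → Dec (A ⇔ B)
  a? ⇔? b? = map′ (λ (f , g) → mk⇔ f g) (λ e → Equivalence.to e , Equivalence.from e)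
    ((a? →-dec b?) ×-dec (b? →-dec a?))

  orderIsomorphicAt? : (p : Word (length τ) n) → Dec (OrderIsomorphicAt τ π p)
  orderIsomorphicAt? p = all? λ i → all? λ j →
    (List.lookup τ i ℕ.<? List.lookup τ j) ⇔?
    (lookup π (lookup p i) Fin.<? lookup π (lookup p j))

avoids? : (π : Word n n) (T : List Pattern) → Dec (Avoids π T)
avoids? π T = All.all? (λ τ → ¬? (contains? π τ)) T

S : (n : ℕ) → List Pattern → List (Word n n)
S n T = filter (λ π → isPermutation? π ×-dec avoids? π T) (words n n)

-- S n T lists each T-avoiding permutation exactly once, so its length is
-- the cardinality of the set S_n(T).
S-unique : ∀ n T → Unique (S n T)
S-unique n T = filter⁺ _ (words-unique n n)

∈-S : ∀ {T} {π : Word n n} → π ∈ S n T ⇔ (IsPermutation π × Avoids π T)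
∈-S = mk⇔ (proj₂ ∘ ∈-filter⁻ _ {xs = words _ _}) (∈-filter⁺ _ (∈-words _))

PowerSeries : Set
PowerSeries = ℕ → ℚ

infix  4 _≈_
infixl 6 _-_
infixl 7 _*_ _/_

_≈_ : PowerSeries → PowerSeries → Set
_≈_ = _≗_

fromℕ : ℕ → ℚ
fromℕ m = ℤ.+ m ℚ./ 1

constant : ℕ → PowerSeries
constant m zero    = fromℕ m
constant m (suc _) = 0ℚ

x : PowerSeries
x 1 = 1ℚ
x _ = 0ℚ

_-_ : PowerSeries → PowerSeries → PowerSeries
(A - B) n = A n ℚ.- B n

_*_ : PowerSeries → PowerSeries → PowerSeries
(A * B) n = ∑[ i ≤ n ] (A (toℕ i) ℚ.* B (n ∸ toℕ i))

module _ (A : PowerSeries) .{{_ : ℚ.NonZero (A 0)}} where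

  -- The coefficients of x^n, …, x^1, x^0 (in this order) of the inverse.
  inverseCoefficients : ∀ n → Vec ℚ (suc n)
  inverseCoefficients zero    = 1/ A 0 ∷ []
  inverseCoefficients (suc n) = ℚ.- (1/ A 0 ℚ.* s) ∷ es
    where
    es = inverseCoefficients n
    s  = ∑[ i ≤ n ] (A (suc (toℕ i)) ℚ.* lookup es i)

  inverse : PowerSeries
  inverse n = Vec.head (inverseCoefficients n)

  lookup-inverseCoefficients : ∀ n i →
    lookup (inverseCoefficients n) i ≡ inverse (n ∸ toℕ i)
  lookup-inverseCoefficients zero    Fin.zero    = refl
  lookup-inverseCoefficients (suc n) Fin.zero    = refl
  lookup-inverseCoefficients (suc n) (Fin.suc i) = lookup-inverseCoefficients n i

  *-inverseʳ : A * inverse ≈ constant 1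
  *-inverseʳ zero    = trans (ℚ.+-identityʳ _) (ℚ.*-inverseʳ (A 0))
  *-inverseʳ (suc n) = begin
    A 0 ℚ.* (ℚ.- (1/ A 0 ℚ.* s)) ℚ.+ t  ≡⟨ cong₂ ℚ._+_ a≡-s t≡s ⟩
    ℚ.- s ℚ.+ s                         ≡⟨ ℚ.+-inverseˡ s ⟩
    0ℚ                                  ∎
    where
    open ≡-Reasoning
    s t : ℚ
    s = ∑[ i ≤ n ] (A (suc (toℕ i)) ℚ.* lookup (inverseCoefficients n) i)
    t = ∑[ i ≤ n ] (A (suc (toℕ i)) ℚ.* inverse (n ∸ toℕ i))

    t≡s : t ≡ s
    t≡s = sum-cong-≗ λ i →
      cong (A (suc (toℕ i)) ℚ.*_) (sym (lookup-inverseCoefficients n i))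

    a≡-s : A 0 ℚ.* (ℚ.- (1/ A 0 ℚ.* s)) ≡ ℚ.- s
    a≡-s = begin
      A 0 ℚ.* (ℚ.- (1/ A 0 ℚ.* s))  ≡⟨ ℚ.neg-distribʳ-* (A 0) (1/ A 0 ℚ.* s) ⟨
      ℚ.- (A 0 ℚ.* (1/ A 0 ℚ.* s))  ≡⟨ cong ℚ.-_ (ℚ.*-assoc (A 0) (1/ A 0) s) ⟨
      ℚ.- (A 0 ℚ.* 1/ A 0 ℚ.* s)    ≡⟨ cong (λ u → ℚ.- (u ℚ.* s)) (ℚ.*-inverseʳ (A 0)) ⟩
      ℚ.- (1ℚ ℚ.* s)                ≡⟨ cong ℚ.-_ (ℚ.*-identityˡ s) ⟩
      ℚ.- s                         ∎

_/_ : (A B : PowerSeries) .{{_ : ℚ.NonZero (B 0)}} → PowerSeries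
A / B = A * inverse B

F : List Pattern → PowerSeries
F T n = fromℕ (length (S n T))

-- The generating function of the Catalan numbers.
C : PowerSeries
C n = ℤ.+ ((2 ℕ.* n) choose n) ℚ./ suc n

-- Build T-avoiding permutations from right to left: prepending a letter v (and
-- raising the letters ≥ v by one) keeps T avoided exactly when v is an "active
-- site".  Which sites are active is governed by a generating tree with two
-- families of nodes,
--
--   J(c, b) → K(1)^c, J(c, b + 1), J(0, i) for 2 ≤ i ≤ b, J(b, 1)      (b ≥ 1),
--   K(a)    → K(1), …, K(a + 1), J(0, 1),
--
-- and the permutation of length 1 is the node J(0, 1).  Let K_a and J_{c,b} be
-- the series counting the descendants by depth.  The rules give
-- K_{a+1} - K_a = x K_{a+2} and, for I_b = J_{0,b} and a series E that does not
-- depend on b, I_{b+1} - I_b = x (E + I_{b+2}).  Since C - 1 = x C², these are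
-- solved by K_a = C^{a+1} F and J_{c,b} = C^b Q + (c - 1) E with suitable Q, and
-- the initial conditions then determine F = 1 + x J_{0,1}.
module Submission where

open import Defs
open import Data.List using (List; []; _∷_)
open import Data.Nat using (nonZero)

open import Algebra.Bundles using (CommutativeRing)
open import Algebra.Solver.Ring.AlmostCommutativeRing
  using (fromCommutativeRing; _-Raw-AlmostCommutative⟶_)
open import Data.Bool using (if_then_else_; true; false)
open import Data.Empty using (⊥-elim)
open import Data.Fin as Fin using (Fin; toℕ; fromℕ<; punchIn; punchOut)
open import Data.Fin.Patterns using (0F; 1F; 2F; 3F)
open import Data.Fin.Properties as Fin using ()
open import Data.Integer as ℤ using (ℤ; +_; -[1+_])
open import Data.Integer.Properties as ℤ using ()
open import Data.List as List using (length; map)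
open import Data.List.Membership.Propositional using (_∈_)
open import Data.List.Membership.Propositional.Properties
  using (∈-map⁺; ∈-map⁻; ∈-allFin; ∈-cartesianProductWith⁺; ∈-cartesianProductWith⁻; ∈-filter⁺; ∈-filter⁻)
open import Data.List.Membership.Propositional.Properties.WithK using (unique∧set⇒bag)
open import Data.List.Properties as List using (∷-injectiveˡ; ∷-injectiveʳ)
open import Data.List.Relation.Binary.BagAndSetEquality using (∼bag⇒↭)
open import Data.List.Relation.Binary.Permutation.Propositional using (_↭_)
open import Data.List.Relation.Binary.Permutation.Propositional.Properties as ↭ using ()
open import Data.List.Relation.Binary.Sublist.Propositional
  using (_⊆_; []; _∷_; _∷ʳ_; from∈; minimum) renaming (lookup to ⊆-lookup)
open import Data.List.Relation.Binary.Sublist.Propositional.Properties using (map⁺)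
open import Data.List.Relation.Unary.All using ([]; _∷_)
open import Data.List.Relation.Unary.Any using (here; there)
open import Data.List.Relation.Unary.Unique.Propositional.Properties
  using (allFin⁺; cartesianProductWith⁺; filter⁺)
open import Data.Maybe using (Maybe; just; nothing)
open import Data.Nat as ℕ using (ℕ; zero; suc; _≤_; _<_; z≤n; s≤s; _∸_; _!)
open import Data.Nat.Combinatorics
  using (nCk≡n!/k![n-k]!; k![n∸k]!∣n!) renaming (_C_ to _choose_)
open import Data.Nat.DivMod as ℕ using ()
open import Data.Nat.ListAction using (sum)
open import Data.Nat.ListAction.Properties using (sum-++; sum-↭)
open import Data.Nat.Properties as ℕ
  using (+-assoc; +-identityʳ; +-suc; <-asym; <-irrefl; <-trans; <-≤-trans; <⇒≤; <⇒≱; _!*_!≢0; _<?_; _≟_; _≤?_; m≤m+n; m≤n⇒m<n∨m≡n; n<1+n; n≤1+n; n≮0; suc-injective; ≤-<-trans; ≤-antisym; ≤-pred; ≤-refl; ≤-reflexive; ≤-trans; ≮⇒≥; ≰⇒>)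
open import Data.Nat.Solver renaming (module +-*-Solver to ℕ-Solver)
open import Data.Product using (∃; ∃₂; _×_; _,_; proj₁)
open import Data.Rational as ℚ using (ℚ; 0ℚ; 1ℚ)
open import Data.Rational.Properties as ℚ using ()
open import Data.Rational.Solver renaming (module +-*-Solver to ℚ-Solver)
open import Data.Rational.Unnormalised as ℚᵘ using (mkℚᵘ; *≡*)
open import Data.Rational.Unnormalised.Properties as ℚᵘ using ()
open import Data.Sum using (inj₁; inj₂)
open import Data.Vec as Vec using (Vec; []; _∷_; lookup)
open import Data.Vec.Properties as Vec using (lookup-map; ∷-injective)
open import Function using (_∘_; mk⇔; Equivalence; Injective)
open import Function.Consequences.Propositional
  using (strictlySurjective⇒surjective; surjective⇒strictlySurjective)
open import Relation.Binary.PropositionalEquality hiding (setoid)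
open import Relation.Nullary using (Dec; ¬_; yes; no; does)
open import Relation.Nullary.Decidable using (dec-true; dec-false)

open import Algebra.Properties.CommutativeMonoid.Sum ℚ.+-0-commutativeMonoid
  using (sum-syntax; sum⁺-syntax; sum-cong-≗; ∑-distrib-+; sum-replicate-zero) renaming (sum to ∑)
open import Algebra.Properties.CommutativeSemigroup
  (CommutativeRing.*-commutativeSemigroup ℚ.+-*-commutativeRing) using (x∙yz≈y∙xz)
open import Algebra.Properties.Group ℚ.+-0-group using (⁻¹-involutive)
open import Algebra.Properties.Semiring.Sum
  (CommutativeRing.semiring ℚ.+-*-commutativeRing) using (*-distribˡ-sum)

-- A prepended letter can only be the first letter of an occurrence. So an inactive site never
-- revives, and an active one dies only through the newest letter, acting as the 2 of a 213, the 3
-- of a 321 or the 1 of a 132. The future of a permutation thus depends only on the relative order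
-- of the letters between its active sites; the state records keep just enough of it, together with
-- the exact set of active sites. The closed forms are verified rather than derived. Every rule
-- carries a factor x, so the recurrences fix degree m + 1 from degree m, and the candidates satisfy
-- them by polynomial identities modulo C = 1 + x C² and denominator * G = 1. E is the increment
-- J_{c+1,b} - J_{c,b}: one more child K(1) gives E = x (K_1 + E), so (1 - x) E = x C² F = (C - 1)
-- F. Hence the numerator 1 - x: with F = (1 - x) G, the series E is simply (C - 1) G.

private
  variable
    k n : ℕ

-- Active sites

-- The effect of `punchIn v` on plain natural numbers, free of bounds.
up : ℕ → ℕ → ℕ
up zero    i       = suc i
up (suc v) zero    = zero
up (suc v) (suc i) = suc (up v i)

up-< : ∀ {v i} → i < v → up v i ≡ i
up-< {suc v} {zero}  _         = refl
up-< {suc v} {suc i} (s≤s i<v) = cong suc (up-< i<v)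

up-≥ : ∀ {v i} → v ≤ i → up v i ≡ suc i
up-≥ {zero}          _         = refl
up-≥ {suc v} {suc i} (s≤s v≤i) = cong suc (up-≥ v≤i)

up-mono-< : ∀ v {i j} → i < j → up v i < up v j
up-mono-< zero                    i<j       = s≤s i<j
up-mono-< (suc v) {zero}  {suc j} _         = s≤s z≤n
up-mono-< (suc v) {suc i} {suc j} (s≤s i<j) = s≤s (up-mono-< v i<j)

up-cancel-< : ∀ v {i j} → up v i < up v j → i < j
up-cancel-< zero                    (s≤s i<j) = i<j
up-cancel-< (suc v) {zero}  {suc j} _         = s≤s z≤n
up-cancel-< (suc v) {suc i} {suc j} (s≤s i<j) = s≤s (up-cancel-< v i<j)

up-injective : ∀ v {i j} → up v i ≡ up v j → i ≡ j
up-injective zero                    eq = suc-injective eq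
up-injective (suc v) {zero}  {zero}  eq = refl
up-injective (suc v) {suc i} {suc j} eq = cong suc (up-injective v (suc-injective eq))

up≢ : ∀ v i → v ≢ up v i
up≢ (suc v) (suc i) eq = up≢ v i (suc-injective eq)

up<v : ∀ {v i} → i < v → up v i < v
up<v {v} i<v = subst (_< v) (sym (up-< i<v)) i<v

up<v⁻ : ∀ {v i} → up v i < v → i < v
up<v⁻ {v} {i} up<v with i <? v
... | yes i<v = i<v
... | no  i≮v = ⊥-elim (<-asym (subst (_< v) (up-≥ (≮⇒≥ i≮v)) up<v) (s≤s (≮⇒≥ i≮v)))

v<up : ∀ {v i} → v ≤ i → v < up v i
v<up {v} v≤i = subst (v <_) (sym (up-≥ v≤i)) (s≤s v≤i)

v<up⁻ : ∀ {v i} → v < up v i → v ≤ i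
v<up⁻ {v} {i} v<up with i <? v
... | yes i<v = ⊥-elim (<-asym v<up (up<v i<v))
... | no  i≮v = ≮⇒≥ i≮v

i≤up : ∀ v i → i ≤ up v i
i≤up zero    i       = n≤1+n i
i≤up (suc v) zero    = z≤n
i≤up (suc v) (suc i) = s≤s (i≤up v i)

up≤suc : ∀ v i → up v i ≤ suc i
up≤suc zero    i       = ≤-refl
up≤suc (suc v) zero    = z≤n
up≤suc (suc v) (suc i) = s≤s (up≤suc v i)

-- Raising the letters from v on moves none of them across a site w ≤ v, so comparisons with w
-- survive in both directions.
module _ {v w : ℕ} (w≤v : w ≤ v) where

  below-≤⁺ : ∀ {i} → w ≤ i → w ≤ up v i
  below-≤⁺ {i} w≤i = ≤-trans w≤i (i≤up v i)

  below-≤⁻ : ∀ {i} → w ≤ up v i → w ≤ i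
  below-≤⁻ {i} w≤up with i <? v
  ... | yes i<v = subst (w ≤_) (up-< i<v) w≤up
  ... | no  i≮v = ≤-trans w≤v (≮⇒≥ i≮v)

  below-<⁺ : ∀ {i} → i < w → up v i < w
  below-<⁺ {i} i<w = subst (_< w) (sym (up-< (<-≤-trans i<w w≤v))) i<w

  below-<⁻ : ∀ {i} → up v i < w → i < w
  below-<⁻ {i} up<w = ≤-<-trans (i≤up v i) up<w

-- The new letter v lies below a site u ≥ v, which therefore becomes the site `suc u`.
module _ {v u : ℕ} (v≤u : v ≤ u) where

  above-≤⁺ : ∀ {i} → u ≤ i → suc u ≤ up v i
  above-≤⁺ u≤i = subst (suc u ≤_) (sym (up-≥ (≤-trans v≤u u≤i))) (s≤s u≤i)

  above-≤⁻ : ∀ {i} → suc u ≤ up v i → u ≤ i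
  above-≤⁻ {i} u<up = ≤-pred (≤-trans u<up (up≤suc v i))

  above-<⁺ : ∀ {i} → i < u → up v i < suc u
  above-<⁺ {i} i<u = s≤s (≤-trans (up≤suc v i) i<u)

  above-<⁻ : ∀ {i} → up v i < suc u → i < u
  above-<⁻ {i} up≤u with i <? u
  ... | yes i<u = i<u
  ... | no  i≮u = ⊥-elim (<-irrefl refl (≤-trans (above-≤⁺ (≮⇒≥ i≮u)) (≤-pred up≤u)))

-- Prepending a letter: occurrences and the fate of the other sites

infixr 5 _◂_

_◂_ : ℕ → List ℕ → List ℕ
v ◂ xs = v ∷ map (up v) xs

⊆-map⁻ : ∀ {A B : Set} (f : A → B) {ys} xs → ys ⊆ map f xs → ∃ λ zs → zs ⊆ xs × ys ≡ map f zs
⊆-map⁻ f []       []       = [] , [] , refl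
⊆-map⁻ f (x ∷ xs) (_ ∷ʳ s) with zs , t , refl ← ⊆-map⁻ f xs s = zs , x ∷ʳ t , refl
⊆-map⁻ f (x ∷ xs) (refl ∷ s) with zs , t , refl ← ⊆-map⁻ f xs s = x ∷ zs , refl ∷ t , refl

⊆-◂⁺ : ∀ {v xs zs} → zs ⊆ xs → map (up v) zs ⊆ v ◂ xs
⊆-◂⁺ {v} s = v ∷ʳ map⁺ (up v) s

⊆-◂-head⁺ : ∀ {v xs zs} → zs ⊆ xs → v ∷ map (up v) zs ⊆ v ◂ xs
⊆-◂-head⁺ {v} s = refl ∷ map⁺ (up v) s

data ⊆-◂-View (v : ℕ) (xs ys : List ℕ) : Set where
  in-tail : ∀ {zs} → zs ⊆ xs → ys ≡ map (up v) zs → ⊆-◂-View v xs ys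
  at-head : ∀ {zs} → zs ⊆ xs → ys ≡ v ∷ map (up v) zs → ⊆-◂-View v xs ys

⊆-◂-view : ∀ {v xs ys} → ys ⊆ v ◂ xs → ⊆-◂-View v xs ys
⊆-◂-view {v} {xs} (_ ∷ʳ s) with _ , t , eq ← ⊆-map⁻ (up v) xs s = in-tail t eq
⊆-◂-view {v} {xs} (refl ∷ s) with _ , t , eq ← ⊆-map⁻ (up v) xs s = at-head t (cong (v ∷_) eq)

-- The patterns that a new first letter w would complete to an element of T.
record Active (xs : List ℕ) (w : ℕ) : Set where
  field
    no-213 : ∀ {a b c} → w ≤ a → a < b → b < c → ¬ (b ∷ a ∷ c ∷ []) ⊆ xs
    no-321 : ∀ {a b c} → w ≤ a → a < b → b < c → ¬ (c ∷ b ∷ a ∷ []) ⊆ xs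
    no-132 : ∀ {a b c} → a < b → b < w → w ≤ c → ¬ (a ∷ c ∷ b ∷ []) ⊆ xs

open Active

-- The names a < b < c < d are ranks by value; their order in the list spells the pattern.
record Avoiding (xs : List ℕ) : Set where
  field
    no-1324 : ∀ {a b c d} → a < b → b < c → c < d → ¬ (a ∷ c ∷ b ∷ d ∷ []) ⊆ xs
    no-1432 : ∀ {a b c d} → a < b → b < c → c < d → ¬ (a ∷ d ∷ c ∷ b ∷ []) ⊆ xs
    no-3142 : ∀ {a b c d} → a < b → b < c → c < d → ¬ (c ∷ a ∷ d ∷ b ∷ []) ⊆ xs

open Avoiding

avoiding-tail : ∀ {v xs} → Avoiding (v ◂ xs) → Avoiding xs
avoiding-tail {v} A = record
  { no-1324 = λ a<b b<c c<d s → no-1324 A (↑ a<b) (↑ b<c) (↑ c<d) (⊆-◂⁺ s)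
  ; no-1432 = λ a<b b<c c<d s → no-1432 A (↑ a<b) (↑ b<c) (↑ c<d) (⊆-◂⁺ s)
  ; no-3142 = λ a<b b<c c<d s → no-3142 A (↑ a<b) (↑ b<c) (↑ c<d) (⊆-◂⁺ s)
  }
  where
  ↑ : ∀ {i j} → i < j → up v i < up v j
  ↑ = up-mono-< v

avoiding-active : ∀ {v xs} → Avoiding (v ◂ xs) → Active xs v
avoiding-active {v} A = record
  { no-213 = λ v≤a a<b b<c s → no-1324 A (v<up v≤a) (up-mono-< v a<b) (up-mono-< v b<c) (⊆-◂-head⁺ s)
  ; no-321 = λ v≤a a<b b<c s → no-1432 A (v<up v≤a) (up-mono-< v a<b) (up-mono-< v b<c) (⊆-◂-head⁺ s)
  ; no-132 = λ a<b b<v v≤c s → no-3142 A (up-mono-< v a<b) (up<v b<v) (v<up v≤c) (⊆-◂-head⁺ s)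
  }

avoiding-◂ : ∀ {v xs} → Avoiding xs → Active xs v → Avoiding (v ◂ xs)
avoiding-◂ {v} {xs} A V = record
  { no-1324 = λ a<b b<c c<d s → 1324-case a<b b<c c<d (⊆-◂-view s)
  ; no-1432 = λ a<b b<c c<d s → 1432-case a<b b<c c<d (⊆-◂-view s)
  ; no-3142 = λ a<b b<c c<d s → 3142-case a<b b<c c<d (⊆-◂-view s)
  }
  where
  ↓ : ∀ {i j} → up v i < up v j → i < j
  ↓ = up-cancel-< v

  1324-case : ∀ {a b c d} → a < b → b < c → c < d → ¬ ⊆-◂-View v xs (a ∷ c ∷ b ∷ d ∷ [])
  1324-case a<b b<c c<d (in-tail {_ ∷ _ ∷ _ ∷ _ ∷ []} s refl) = no-1324 A (↓ a<b) (↓ b<c) (↓ c<d) s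
  1324-case a<b b<c c<d (at-head {_ ∷ _ ∷ _ ∷ []} s refl)     = no-213 V (v<up⁻ a<b) (↓ b<c) (↓ c<d) s

  1432-case : ∀ {a b c d} → a < b → b < c → c < d → ¬ ⊆-◂-View v xs (a ∷ d ∷ c ∷ b ∷ [])
  1432-case a<b b<c c<d (in-tail {_ ∷ _ ∷ _ ∷ _ ∷ []} s refl) = no-1432 A (↓ a<b) (↓ b<c) (↓ c<d) s
  1432-case a<b b<c c<d (at-head {_ ∷ _ ∷ _ ∷ []} s refl)     = no-321 V (v<up⁻ a<b) (↓ b<c) (↓ c<d) s

  3142-case : ∀ {a b c d} → a < b → b < c → c < d → ¬ ⊆-◂-View v xs (c ∷ a ∷ d ∷ b ∷ [])
  3142-case a<b b<c c<d (in-tail {_ ∷ _ ∷ _ ∷ _ ∷ []} s refl) = no-3142 A (↓ a<b) (↓ b<c) (↓ c<d) s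
  3142-case a<b b<c c<d (at-head {_ ∷ _ ∷ _ ∷ []} s refl)     = no-132 V (↓ a<b) (up<v⁻ b<c) (v<up⁻ c<d) s

module _ {v w : ℕ} {xs : List ℕ} (w≤v : w ≤ v) where

  active-below⁻ : Active (v ◂ xs) w → Active xs w
  active-below⁻ V = record
    { no-213 = λ w≤a a<b b<c s → no-213 V (below-≤⁺ w≤v w≤a) (up-mono-< v a<b) (up-mono-< v b<c) (⊆-◂⁺ s)
    ; no-321 = λ w≤a a<b b<c s → no-321 V (below-≤⁺ w≤v w≤a) (up-mono-< v a<b) (up-mono-< v b<c) (⊆-◂⁺ s)
    ; no-132 = λ a<b b<w w≤c s → no-132 V (up-mono-< v a<b) (below-<⁺ w≤v b<w) (below-≤⁺ w≤v w≤c) (⊆-◂⁺ s)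
    }

  -- The new letter is the 2 of a 213, with a as the 1 and c as the 3.
  active-below-straddle : Active (v ◂ xs) w → ∀ {a c} → w ≤ a → a < v → v ≤ c → ¬ (a ∷ c ∷ []) ⊆ xs
  active-below-straddle V w≤a a<v v≤c s =
    no-213 V (below-≤⁺ w≤v w≤a) (up<v a<v) (v<up v≤c) (⊆-◂-head⁺ s)

  -- The new letter is the 3 of a 321.
  active-below-inversion : Active (v ◂ xs) w → ∀ {a b} → w ≤ a → a < b → b < v → ¬ (b ∷ a ∷ []) ⊆ xs
  active-below-inversion V w≤a a<b b<v s =
    no-321 V (below-≤⁺ w≤v w≤a) (up-mono-< v a<b) (up<v b<v) (⊆-◂-head⁺ s)

  -- As the 1 of a 132 the new letter would have to lie below w ≤ v, so the two obstructions above
  -- are the only new ones.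
  active-below⁺ : Active xs w →
    (∀ {a c} → w ≤ a → a < v → v ≤ c → ¬ (a ∷ c ∷ []) ⊆ xs) →
    (∀ {a b} → w ≤ a → a < b → b < v → ¬ (b ∷ a ∷ []) ⊆ xs) →
    Active (v ◂ xs) w
  active-below⁺ W straddle inversion = record
    { no-213 = λ w≤a a<b b<c s → 213-case w≤a a<b b<c (⊆-◂-view s)
    ; no-321 = λ w≤a a<b b<c s → 321-case w≤a a<b b<c (⊆-◂-view s)
    ; no-132 = λ a<b b<w w≤c s → 132-case a<b b<w w≤c (⊆-◂-view s)
    }
    where
    ↓ : ∀ {i j} → up v i < up v j → i < j
    ↓ = up-cancel-< v

    213-case : ∀ {a b c} → w ≤ a → a < b → b < c → ¬ ⊆-◂-View v xs (b ∷ a ∷ c ∷ [])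
    213-case w≤a a<b b<c (in-tail {_ ∷ _ ∷ _ ∷ []} s refl) = no-213 W (below-≤⁻ w≤v w≤a) (↓ a<b) (↓ b<c) s
    213-case w≤a a<b b<c (at-head {_ ∷ _ ∷ []} s refl)     = straddle (below-≤⁻ w≤v w≤a) (up<v⁻ a<b) (v<up⁻ b<c) s

    321-case : ∀ {a b c} → w ≤ a → a < b → b < c → ¬ ⊆-◂-View v xs (c ∷ b ∷ a ∷ [])
    321-case w≤a a<b b<c (in-tail {_ ∷ _ ∷ _ ∷ []} s refl) = no-321 W (below-≤⁻ w≤v w≤a) (↓ a<b) (↓ b<c) s
    321-case w≤a a<b b<c (at-head {_ ∷ _ ∷ []} s refl)     = inversion (below-≤⁻ w≤v w≤a) (↓ a<b) (up<v⁻ b<c) s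

    132-case : ∀ {a b c} → a < b → b < w → w ≤ c → ¬ ⊆-◂-View v xs (a ∷ c ∷ b ∷ [])
    132-case a<b b<w w≤c (in-tail {_ ∷ _ ∷ _ ∷ []} s refl) = no-132 W (↓ a<b) (below-<⁻ w≤v b<w) (below-≤⁻ w≤v w≤c) s
    132-case a<b b<w w≤c (at-head {_ ∷ _ ∷ []} s refl)     = <-irrefl refl (<-≤-trans (<-trans a<b b<w) w≤v)

module _ {v u : ℕ} {xs : List ℕ} (v≤u : v ≤ u) where

  active-above⁻ : Active (v ◂ xs) (suc u) → Active xs u
  active-above⁻ V = record
    { no-213 = λ u≤a a<b b<c s → no-213 V (above-≤⁺ v≤u u≤a) (up-mono-< v a<b) (up-mono-< v b<c) (⊆-◂⁺ s)
    ; no-321 = λ u≤a a<b b<c s → no-321 V (above-≤⁺ v≤u u≤a) (up-mono-< v a<b) (up-mono-< v b<c) (⊆-◂⁺ s)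
    ; no-132 = λ a<b b<u u≤c s → no-132 V (up-mono-< v a<b) (above-<⁺ v≤u b<u) (above-≤⁺ v≤u u≤c) (⊆-◂⁺ s)
    }

  -- The new letter is the 1 of a 132 whose other letters lie on the two sides of the site.
  active-above-inversion : Active (v ◂ xs) (suc u) → ∀ {b c} → v ≤ b → b < u → u ≤ c → ¬ (c ∷ b ∷ []) ⊆ xs
  active-above-inversion V v≤b b<u u≤c s =
    no-132 V (v<up v≤b) (above-<⁺ v≤u b<u) (above-≤⁺ v≤u u≤c) (⊆-◂-head⁺ s)

  -- The new letter lies below the site `suc u`, whereas a harmful 213 or 321 lies entirely above
  -- it; only the 132 can be new.
  active-above⁺ : Active xs u →
    (∀ {b c} → v ≤ b → b < u → u ≤ c → ¬ (c ∷ b ∷ []) ⊆ xs) →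
    Active (v ◂ xs) (suc u)
  active-above⁺ U inversion = record
    { no-213 = λ u≤a a<b b<c s → 213-case u≤a a<b b<c (⊆-◂-view s)
    ; no-321 = λ u≤a a<b b<c s → 321-case u≤a a<b b<c (⊆-◂-view s)
    ; no-132 = λ a<b b<u u≤c s → 132-case a<b b<u u≤c (⊆-◂-view s)
    }
    where
    ↓ : ∀ {i j} → up v i < up v j → i < j
    ↓ = up-cancel-< v

    absurd : ∀ {a} → suc u ≤ a → ¬ (a < v)
    absurd u<a a<v = <-asym u<a (<-≤-trans a<v v≤u)

    213-case : ∀ {a b c} → suc u ≤ a → a < b → b < c → ¬ ⊆-◂-View v xs (b ∷ a ∷ c ∷ [])
    213-case u<a a<b b<c (in-tail {_ ∷ _ ∷ _ ∷ []} s refl) = no-213 U (above-≤⁻ v≤u u<a) (↓ a<b) (↓ b<c) s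
    213-case u<a a<b b<c (at-head {_ ∷ _ ∷ []} s refl)     = absurd u<a a<b

    321-case : ∀ {a b c} → suc u ≤ a → a < b → b < c → ¬ ⊆-◂-View v xs (c ∷ b ∷ a ∷ [])
    321-case u<a a<b b<c (in-tail {_ ∷ _ ∷ _ ∷ []} s refl) = no-321 U (above-≤⁻ v≤u u<a) (↓ a<b) (↓ b<c) s
    321-case u<a a<b b<c (at-head {_ ∷ _ ∷ []} s refl)     = absurd u<a (<-trans a<b b<c)

    132-case : ∀ {a b c} → a < b → b < suc u → suc u ≤ c → ¬ ⊆-◂-View v xs (a ∷ c ∷ b ∷ [])
    132-case a<b b≤u u<c (in-tail {_ ∷ _ ∷ _ ∷ []} s refl) = no-132 U (↓ a<b) (above-<⁻ v≤u b≤u) (above-≤⁻ v≤u u<c) s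
    132-case a<b b≤u u<c (at-head {_ ∷ _ ∷ []} s refl)     = inversion (v<up⁻ a<b) (above-<⁻ v≤u b≤u) (above-≤⁻ v≤u u<c) s

-- Relative order of letters

infix 4 _⊢_≺_

_⊢_≺_ : List ℕ → ℕ → ℕ → Set
xs ⊢ i ≺ j = (i ∷ j ∷ []) ⊆ xs

-- A permutation of 0, ..., n - 1 as a list; `asym` at i = j excludes repeated letters.
record Arrangement (n : ℕ) (xs : List ℕ) : Set where
  field
    bounded  : ∀ {i} → i ∈ xs → i < n
    complete : ∀ {i} → i < n → i ∈ xs
    asym     : ∀ {i j} → xs ⊢ i ≺ j → ¬ xs ⊢ j ≺ i

open Arrangement

arrangement-[] : Arrangement 0 []
arrangement-[] = record { bounded = λ () ; complete = λ () ; asym = λ () }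

up-cover : ∀ v i → v ≢ i → ∃ λ j → i ≡ up v j
up-cover zero    zero    v≢i = ⊥-elim (v≢i refl)
up-cover zero    (suc i) v≢i = i , refl
up-cover (suc v) zero    v≢i = zero , refl
up-cover (suc v) (suc i) v≢i with j , eq ← up-cover v i (λ eq → v≢i (cong suc eq)) = suc j , cong suc eq

module _ {n : ℕ} {xs : List ℕ} (P : Arrangement n xs) where

  left< : ∀ {i j} → xs ⊢ i ≺ j → i < n
  left< s = bounded P (⊆-lookup s (here refl))

  right< : ∀ {i j} → xs ⊢ i ≺ j → j < n
  right< s = bounded P (⊆-lookup s (there (here refl)))

  module _ {v : ℕ} (v≤n : v ≤ n) where

    arrangement-◂ : Arrangement (suc n) (v ◂ xs)
    arrangement-◂ = record { bounded = bounded′ ; complete = complete′ ; asym = λ s t → asym′ (⊆-◂-view s) (⊆-◂-view t) }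
      where
      bounded′ : ∀ {i} → i ∈ v ◂ xs → i < suc n
      bounded′ (here refl) = s≤s v≤n
      bounded′ (there i∈) with j , j∈ , refl ← ∈-map⁻ (up v) i∈ = s≤s (≤-trans (up≤suc v j) (bounded P j∈))

      complete′ : ∀ {i} → i < suc n → i ∈ v ◂ xs
      complete′ {i} (s≤s i≤n) with v ≟ i
      ... | yes refl = here refl
      ... | no  v≢i with j , refl ← up-cover v i v≢i = there (∈-map⁺ (up v) (complete P j<n))
        where
        j<n : j < n
        j<n = above-<⁻ v≤n (s≤s i≤n)

      asym′ : ∀ {i j} → ⊆-◂-View v xs (i ∷ j ∷ []) → ¬ ⊆-◂-View v xs (j ∷ i ∷ [])
      asym′ (in-tail {_ ∷ b ∷ []} s refl) (in-tail {_ ∷ _ ∷ []} t eq)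
        with refl ← up-injective v (∷-injectiveˡ eq)
           | refl ← up-injective v (∷-injectiveˡ (∷-injectiveʳ eq)) = asym P s t
      asym′ (in-tail {_ ∷ b ∷ []} s refl) (at-head {_ ∷ []} t eq) = up≢ v b (sym (∷-injectiveˡ eq))
      asym′ (at-head {b ∷ []} s refl) (in-tail {_ ∷ c ∷ []} t eq) = up≢ v c (∷-injectiveˡ (∷-injectiveʳ eq))
      asym′ (at-head {b ∷ []} s refl) (at-head {_ ∷ []} t eq) = up≢ v b (sym (∷-injectiveˡ eq))

    ≺-head-above : ∀ {j} → v ≤ j → j < n → v ◂ xs ⊢ v ≺ suc j
    ≺-head-above {j} v≤j j<n =
      subst (v ◂ xs ⊢ v ≺_) (up-≥ v≤j) (⊆-◂-head⁺ (from∈ (complete P j<n)))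

    ≺-head-below : ∀ {j} → j < v → v ◂ xs ⊢ v ≺ j
    ≺-head-below {j} j<v =
      subst (v ◂ xs ⊢ v ≺_) (up-< j<v) (⊆-◂-head⁺ (from∈ (complete P (<-≤-trans j<v v≤n))))

≺-above : ∀ {xs v i j} → v ≤ i → v ≤ j → xs ⊢ i ≺ j → v ◂ xs ⊢ suc i ≺ suc j
≺-above {xs} {v} v≤i v≤j s = subst₂ (v ◂ xs ⊢_≺_) (up-≥ v≤i) (up-≥ v≤j) (⊆-◂⁺ s)

≺-below : ∀ {xs v i j} → i < v → j < v → xs ⊢ i ≺ j → v ◂ xs ⊢ i ≺ j
≺-below {xs} {v} i<v j<v s = subst₂ (v ◂ xs ⊢_≺_) (up-< i<v) (up-< j<v) (⊆-◂⁺ s)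

≺-above-below : ∀ {xs v i j} → v ≤ i → j < v → xs ⊢ i ≺ j → v ◂ xs ⊢ suc i ≺ j
≺-above-below {xs} {v} v≤i j<v s = subst₂ (v ◂ xs ⊢_≺_) (up-≥ v≤i) (up-< j<v) (⊆-◂⁺ s)

-- The generating tree

-- The node J(e - d, n - e): the letters in [e, n) increase and all precede those
-- in [d, e), which increase too.
record StateJ (d e n : ℕ) (xs : List ℕ) : Set where
  field
    d≤e         : d ≤ e
    e<n         : e < n
    arrangement : Arrangement n xs
    active      : ∀ {w} → d ≤ w → w ≤ n → Active xs w
    inactive    : ∀ {w} → w < d → ¬ Active xs w
    low         : ∀ {i j} → d ≤ i → i < j → j < e → xs ⊢ i ≺ j
    high        : ∀ {i j} → e ≤ i → i < j → j < n → xs ⊢ i ≺ j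
    cross       : ∀ {i j} → d ≤ i → i < e → e ≤ j → j < n → xs ⊢ j ≺ i

-- The node K(e - d): each letter in [d, e) precedes all larger ones, while the
-- letters in [e, n) are not increasing.
record StateK (d e n : ℕ) (xs : List ℕ) : Set where
  field
    d≤e         : d ≤ e
    e<n         : e < n
    arrangement : Arrangement n xs
    active      : ∀ {w} → d ≤ w → w ≤ e → Active xs w
    active-top  : Active xs n
    inactive    : ∀ {w} → w < d → ¬ Active xs w
    inactive′   : ∀ {w} → e < w → w < n → ¬ Active xs w
    initial     : ∀ {i j} → d ≤ i → i < e → i < j → j < n → xs ⊢ i ≺ j
    inversion   : ∃₂ λ i j → e ≤ i × i < j × j < n × xs ⊢ j ≺ i

module _ {d e n : ℕ} {xs : List ℕ} (st : StateJ d e n xs) where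
  open StateJ st

  private
    ¬low : ∀ {i j} → d ≤ i → i < j → j < e → ¬ xs ⊢ j ≺ i
    ¬low d≤i i<j j<e s = asym arrangement s (low d≤i i<j j<e)

    ¬high : ∀ {i j} → e ≤ i → i < j → ¬ xs ⊢ j ≺ i
    ¬high e≤i i<j s = asym arrangement s (high e≤i i<j (left< arrangement s))

    ¬cross : ∀ {i j} → d ≤ i → i < e → e ≤ j → ¬ xs ⊢ i ≺ j
    ¬cross d≤i i<e e≤j s = asym arrangement s (cross d≤i i<e e≤j (right< arrangement s))

    d≤n : d ≤ n
    d≤n = ≤-trans d≤e (<⇒≤ e<n)

  -- The old letter v is raised to `suc v`. With the new v it forms a 213 around each low letter
  -- below it and a 132 around each high letter, so only the sites v, `suc v` and the top one
  -- survive. A high letter ahead of `suc v` is the inversion that a K must have.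
  J-low : ∀ {v} → d ≤ v → v < e → StateK v (suc v) (suc n) (v ◂ xs)
  J-low {v} d≤v v<e = record
    { d≤e         = n≤1+n v
    ; e<n         = s≤s v<n
    ; arrangement = arrangement-◂ arrangement v≤n
    ; active      = active′
    ; active-top  = active-above⁺ v≤n (active d≤n ≤-refl) (λ _ _ n≤c s → <⇒≱ (left< arrangement s) n≤c)
    ; inactive    = λ w<v V → case-below w<v V
    ; inactive′   = case-above
    ; initial     = λ v≤i i<sv i<j j<n → initial′ (≤-antisym (≤-pred i<sv) v≤i) i<j j<n
    ; inversion   = suc v , n , ≤-refl , sv<n , n<1+n n , top-inversion n refl
    }
    where
    v<n : v < n
    v<n = <-trans v<e e<n
    v≤n : v ≤ n
    v≤n = <⇒≤ v<n
    sv<n : suc v < n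
    sv<n = ≤-<-trans v<e e<n

    active′ : ∀ {w} → v ≤ w → w ≤ suc v → Active (v ◂ xs) w
    active′ {w} v≤w w≤sv with m≤n⇒m<n∨m≡n v≤w
    ... | inj₂ refl = active-below⁺ ≤-refl (active d≤v v≤n)
                        (λ v≤a a<v _ _ → <⇒≱ a<v v≤a) (λ v≤a a<b b<v _ → <⇒≱ (<-trans a<b b<v) v≤a)
    ... | inj₁ v<w with refl ← ≤-antisym w≤sv v<w = active-above⁺ ≤-refl (active d≤v v≤n)
                        (λ v≤b b<v _ _ → <⇒≱ b<v v≤b)

    case-below : ∀ {w} → w < v → ¬ Active (v ◂ xs) w
    case-below {w} w<v V with w <? d
    ... | yes w<d = inactive w<d (active-below⁻ (<⇒≤ w<v) V)
    ... | no  w≮d = active-below-straddle (<⇒≤ w<v) V ≤-refl w<v ≤-refl (low (≮⇒≥ w≮d) w<v v<e)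

    case-above : ∀ {w} → suc v < w → w < suc n → ¬ Active (v ◂ xs) w
    case-above {suc u} (s≤s v<u) (s≤s u<n) V with u <? e
    -- The 3 of the 132 must lie above the site: the letter e serves while u < e, afterwards the
    -- letter u itself.
    ... | yes u<e = active-above-inversion (<⇒≤ v<u) V ≤-refl v<u (<⇒≤ u<e) (cross d≤v v<e ≤-refl e<n)
    ... | no  u≮e = active-above-inversion (<⇒≤ v<u) V ≤-refl v<u ≤-refl (cross d≤v v<e (≮⇒≥ u≮e) u<n)

    initial′ : ∀ {i j} → i ≡ v → i < j → j < suc n → v ◂ xs ⊢ i ≺ j
    initial′ {j = suc j} refl (s≤s v≤j) (s≤s j<n) = ≺-head-above arrangement v≤n v≤j j<n

    -- The letter n of the new list is the old largest letter n - 1. The copy m can be split into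
    -- zero and successor, which the fixed parameter n cannot.
    top-inversion : ∀ m → m ≡ n → v ◂ xs ⊢ m ≺ suc v
    top-inversion zero    eq = ⊥-elim (n≮0 (subst (e <_) (sym eq) e<n))
    top-inversion (suc m) eq = ≺-above (≤-trans (<⇒≤ v<e) e≤m) ≤-refl (cross d≤v v<e e≤m (≤-reflexive eq))
      where
      e≤m : e ≤ m
      e≤m = ≤-pred (subst (e <_) (sym eq) e<n)

  -- No site is lost: a 213 with e as its 2 needs a low letter before a high one, a 321 with e as
  -- its 3 a descent among low letters, and a 132 with e as its 1 a descent among high letters. The
  -- new e joins the high block.
  J-middle : StateJ d e (suc n) (e ◂ xs)
  J-middle = record
    { d≤e         = d≤e
    ; e<n         = s≤s e≤n
    ; arrangement = arrangement-◂ arrangement e≤n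
    ; active      = active′
    ; inactive    = λ w<d V → inactive w<d (active-below⁻ (≤-trans (<⇒≤ w<d) d≤e) V)
    ; low         = λ d≤i i<j j<e → ≺-below (<-trans i<j j<e) j<e (low d≤i i<j j<e)
    ; high        = high′
    ; cross       = cross′
    }
    where
    e≤n : e ≤ n
    e≤n = <⇒≤ e<n

    active′ : ∀ {w} → d ≤ w → w ≤ suc n → Active (e ◂ xs) w
    active′ {w} d≤w w≤n with w ≤? e
    ... | yes w≤e = active-below⁺ w≤e (active d≤w (≤-trans w≤e e≤n))
                      (λ w≤a a<e e≤c → ¬cross (≤-trans d≤w w≤a) a<e e≤c)
                      (λ w≤a → ¬low (≤-trans d≤w w≤a))
    active′ {zero}  d≤w w≤n       | no w≰e = ⊥-elim (w≰e z≤n)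
    active′ {suc u} d≤w (s≤s u≤n) | no w≰e = active-above⁺ e≤u (active (≤-trans d≤e e≤u) u≤n)
                      (λ e≤b b<u u≤c → ¬high e≤b (<-≤-trans b<u u≤c))
      where
      e≤u : e ≤ u
      e≤u = ≤-pred (≰⇒> w≰e)

    high′ : ∀ {i j} → e ≤ i → i < j → j < suc n → e ◂ xs ⊢ i ≺ j
    high′ {i} {suc j} e≤i (s≤s i≤j) (s≤s j<n) with m≤n⇒m<n∨m≡n e≤i
    ... | inj₂ refl = ≺-head-above arrangement e≤n i≤j j<n
    ... | inj₁ (s≤s e≤i′) = ≺-above e≤i′ (≤-trans e≤i i≤j) (high e≤i′ i≤j j<n)

    cross′ : ∀ {i j} → d ≤ i → i < e → e ≤ j → j < suc n → e ◂ xs ⊢ j ≺ i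
    cross′ {i} {j} d≤i i<e e≤j j≤n with m≤n⇒m<n∨m≡n e≤j
    ... | inj₂ refl = ≺-head-below arrangement e≤n i<e
    ... | inj₁ (s≤s e≤j′) = ≺-above-below e≤j′ i<e (cross d≤i i<e e≤j′ (≤-pred j≤n))

  -- The new v, a smaller high letter and the raised v form a 213, which kills every site below v.
  -- The letters from v on still increase, so no other site is lost and they form the whole high
  -- block.
  J-high : ∀ {v} → e < v → v < n → StateJ v v (suc n) (v ◂ xs)
  J-high {v} e<v v<n = record
    { d≤e         = ≤-refl
    ; e<n         = <-trans v<n (n<1+n n)
    ; arrangement = arrangement-◂ arrangement v≤n
    ; active      = active′
    ; inactive    = inactive′
    ; low         = λ v≤i i<j j<v → ⊥-elim (<⇒≱ (<-trans i<j j<v) v≤i)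
    ; high        = high′
    ; cross       = λ v≤i i<v → ⊥-elim (<⇒≱ i<v v≤i)
    }
    where
    v≤n : v ≤ n
    v≤n = <⇒≤ v<n
    d≤v : d ≤ v
    d≤v = ≤-trans d≤e (<⇒≤ e<v)

    active′ : ∀ {w} → v ≤ w → w ≤ suc n → Active (v ◂ xs) w
    active′ v≤w w≤n with m≤n⇒m<n∨m≡n v≤w
    ... | inj₂ refl = active-below⁺ ≤-refl (active d≤v v≤n)
                        (λ v≤a a<v _ _ → <⇒≱ a<v v≤a) (λ v≤a a<b b<v _ → <⇒≱ (<-trans a<b b<v) v≤a)
    ... | inj₁ (s≤s v≤u) = active-above⁺ v≤u (active (≤-trans d≤v v≤u) (≤-pred w≤n))
                        (λ v≤b b<u u≤c → ¬high (≤-trans (<⇒≤ e<v) v≤b) (<-≤-trans b<u u≤c))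

    inactive′ : ∀ {w} → w < v → ¬ Active (v ◂ xs) w
    inactive′ {w} w<v V with w <? e
    ... | yes w<e = active-below-straddle (<⇒≤ w<v) V (<⇒≤ w<e) e<v ≤-refl (high ≤-refl e<v v<n)
    ... | no  w≮e = active-below-straddle (<⇒≤ w<v) V ≤-refl w<v ≤-refl (high (≮⇒≥ w≮e) w<v v<n)

    high′ : ∀ {i j} → v ≤ i → i < j → j < suc n → v ◂ xs ⊢ i ≺ j
    high′ {i} {suc j} v≤i (s≤s i≤j) (s≤s j<n) with m≤n⇒m<n∨m≡n v≤i
    ... | inj₂ refl = ≺-head-above arrangement v≤n i≤j j<n
    ... | inj₁ (s≤s v≤i′) = ≺-above v≤i′ (≤-trans v≤i i≤j) (high (≤-trans (<⇒≤ e<v) v≤i′) i≤j j<n)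

  -- The old high letters become the low block, and n alone is the high block. Each old low letter w
  -- comes after e, so n, e, w form a 321 that kills the site w.
  J-top : StateJ e n (suc n) (n ◂ xs)
  J-top = record
    { d≤e         = <⇒≤ e<n
    ; e<n         = n<1+n n
    ; arrangement = arrangement-◂ arrangement ≤-refl
    ; active      = active′
    ; inactive    = inactive′
    ; low         = λ e≤i i<j j<n → ≺-below (<-trans i<j j<n) j<n (high e≤i i<j j<n)
    ; high        = λ n≤i i<j j≤n → ⊥-elim (<⇒≱ (<-≤-trans i<j (≤-pred j≤n)) n≤i)
    ; cross       = cross′
    }
    where
    active′ : ∀ {w} → e ≤ w → w ≤ suc n → Active (n ◂ xs) w
    active′ {w} e≤w w≤sn with m≤n⇒m<n∨m≡n w≤sn
    ... | inj₂ refl = active-above⁺ ≤-refl (active d≤n ≤-refl) (λ n≤b b<n _ _ → <⇒≱ b<n n≤b)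
    ... | inj₁ (s≤s w≤n) = active-below⁺ w≤n (active (≤-trans d≤e e≤w) w≤n)
                      (λ _ _ n≤c s → <⇒≱ (right< arrangement s) n≤c)
                      (λ w≤a a<b _ → ¬high (≤-trans e≤w w≤a) a<b)

    inactive′ : ∀ {w} → w < e → ¬ Active (n ◂ xs) w
    inactive′ {w} w<e V with w <? d
    ... | yes w<d = inactive w<d (active-below⁻ (≤-trans (<⇒≤ w<e) (<⇒≤ e<n)) V)
    ... | no  w≮d = active-below-inversion (≤-trans (<⇒≤ w<e) (<⇒≤ e<n)) V ≤-refl w<e e<n (cross (≮⇒≥ w≮d) w<e ≤-refl e<n)

    cross′ : ∀ {i j} → e ≤ i → i < n → n ≤ j → j < suc n → n ◂ xs ⊢ j ≺ i
    cross′ e≤i i<n n≤j j≤n with refl ← ≤-antisym n≤j (≤-pred j≤n) = ≺-head-below arrangement ≤-refl i<n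

module _ {d e n : ℕ} {xs : List ℕ} (st : StateK d e n xs) where
  open StateK st

  private
    ¬initial : ∀ {i j} → d ≤ i → i < e → i < j → ¬ xs ⊢ j ≺ i
    ¬initial d≤i i<e i<j s = asym arrangement s (initial d≤i i<e i<j (left< arrangement s))

  -- A letter w in [d, v) precedes v, so the new v, w and the raised v form a 213. From v on the
  -- initial letters precede all larger ones, and nothing is lost there.
  K-low : ∀ {v} → d ≤ v → v ≤ e → StateK v (suc e) (suc n) (v ◂ xs)
  K-low {v} d≤v v≤e = record
    { d≤e         = ≤-trans v≤e (n≤1+n e)
    ; e<n         = s≤s e<n
    ; arrangement = arrangement-◂ arrangement v≤n
    ; active      = active′
    ; active-top  = active-above⁺ v≤n active-top (λ _ _ n≤c s → <⇒≱ (left< arrangement s) n≤c)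
    ; inactive    = case-below
    ; inactive′   = case-above
    ; initial     = initial′
    ; inversion   = inversion″ inversion
    }
    where
    v≤n : v ≤ n
    v≤n = ≤-trans v≤e (<⇒≤ e<n)

    active′ : ∀ {w} → v ≤ w → w ≤ suc e → Active (v ◂ xs) w
    active′ {w} v≤w w≤se with m≤n⇒m<n∨m≡n v≤w
    ... | inj₂ refl = active-below⁺ ≤-refl (active d≤v v≤e)
                        (λ v≤a a<v _ _ → <⇒≱ a<v v≤a) (λ v≤a a<b b<v _ → <⇒≱ (<-trans a<b b<v) v≤a)
    ... | inj₁ (s≤s v≤u) = active-above⁺ v≤u (active (≤-trans d≤v v≤u) (≤-pred w≤se))
                        (λ v≤b b<u u≤c → ¬initial (≤-trans d≤v v≤b) (<-≤-trans b<u (≤-pred w≤se)) (<-≤-trans b<u u≤c))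

    case-below : ∀ {w} → w < v → ¬ Active (v ◂ xs) w
    case-below {w} w<v V with w <? d
    ... | yes w<d = inactive w<d (active-below⁻ (<⇒≤ w<v) V)
    ... | no  w≮d = active-below-straddle (<⇒≤ w<v) V ≤-refl w<v ≤-refl
                      (initial (≮⇒≥ w≮d) (<-≤-trans w<v v≤e) w<v (≤-<-trans v≤e e<n))

    case-above : ∀ {w} → suc e < w → w < suc n → ¬ Active (v ◂ xs) w
    case-above {suc u} (s≤s e<u) (s≤s u<n) V = inactive′ e<u u<n (active-above⁻ (≤-trans v≤e (<⇒≤ e<u)) V)

    initial′ : ∀ {i j} → v ≤ i → i < suc e → i < j → j < suc n → v ◂ xs ⊢ i ≺ j
    initial′ {i} {suc j} v≤i i≤e (s≤s i≤j) (s≤s j<n) with m≤n⇒m<n∨m≡n v≤i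
    ... | inj₂ refl = ≺-head-above arrangement v≤n i≤j j<n
    ... | inj₁ (s≤s v≤i′) = ≺-above v≤i′ (≤-trans v≤i i≤j) (initial (≤-trans d≤v v≤i′) (≤-pred i≤e) i≤j j<n)

    inversion″ : (∃₂ λ i j → e ≤ i × i < j × j < n × xs ⊢ j ≺ i) →
      ∃₂ λ i j → suc e ≤ i × i < j × j < suc n × v ◂ xs ⊢ j ≺ i
    inversion″ (i , j , e≤i , i<j , j<n , s) =
      suc i , suc j , s≤s e≤i , s≤s i<j , s≤s j<n , ≺-above (≤-trans v≤i (<⇒≤ i<j)) v≤i s
      where
      v≤i : v ≤ i
      v≤i = ≤-trans v≤e e≤i

  -- The letter n and the recorded inversion form a 321 above every site up to e. The sites between
  -- e and n are already dead, so n and `suc n` remain.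
  K-top : StateJ n n (suc n) (n ◂ xs)
  K-top = record
    { d≤e         = ≤-refl
    ; e<n         = n<1+n n
    ; arrangement = arrangement-◂ arrangement ≤-refl
    ; active      = active′
    ; inactive    = inactive″ inversion
    ; low         = λ n≤i i<j j<n → ⊥-elim (<⇒≱ (<-trans i<j j<n) n≤i)
    ; high        = λ n≤i i<j j≤n → ⊥-elim (<⇒≱ (<-≤-trans i<j (≤-pred j≤n)) n≤i)
    ; cross       = λ n≤i i<n → ⊥-elim (<⇒≱ i<n n≤i)
    }
    where
    active′ : ∀ {w} → n ≤ w → w ≤ suc n → Active (n ◂ xs) w
    active′ {w} n≤w w≤sn with m≤n⇒m<n∨m≡n n≤w
    ... | inj₂ refl = active-below⁺ ≤-refl active-top
                        (λ n≤a a<n _ _ → <⇒≱ a<n n≤a) (λ n≤a a<b b<n _ → <⇒≱ (<-trans a<b b<n) n≤a)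
    ... | inj₁ n<w with refl ← ≤-antisym w≤sn n<w = active-above⁺ ≤-refl active-top
                        (λ n≤b b<n _ _ → <⇒≱ b<n n≤b)

    inactive″ : (∃₂ λ i j → e ≤ i × i < j × j < n × xs ⊢ j ≺ i) → ∀ {w} → w < n → ¬ Active (n ◂ xs) w
    inactive″ (i , j , e≤i , i<j , j<n , s) {w} w<n V with w ≤? e
    ... | yes w≤e = active-below-inversion (<⇒≤ w<n) V (≤-trans w≤e e≤i) i<j j<n s
    ... | no  w≰e = inactive′ (≰⇒> w≰e) w<n (active-below⁻ (<⇒≤ w<n) V)

active-[] : ∀ w → Active [] w
active-[] w = record { no-213 = λ _ _ _ () ; no-321 = λ _ _ _ () ; no-132 = λ _ _ _ () }

state-[0] : StateJ 0 0 1 (0 ◂ [])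
state-[0] = record
  { d≤e         = z≤n
  ; e<n         = s≤s z≤n
  ; arrangement = arrangement-◂ arrangement-[] z≤n
  ; active      = λ _ _ → active-singleton
  ; inactive    = λ ()
  ; low         = λ _ _ ()
  ; high        = λ { _ (s≤s _) (s≤s ()) }
  ; cross       = λ _ ()
  }
  where
  active-singleton : ∀ {w} → Active (0 ◂ []) w
  active-singleton = record
    { no-213 = λ { _ _ _ (_ ∷ʳ ()) ; _ _ _ (_ ∷ ()) }
    ; no-321 = λ { _ _ _ (_ ∷ʳ ()) ; _ _ _ (_ ∷ ()) }
    ; no-132 = λ { _ _ _ (_ ∷ʳ ()) ; _ _ _ (_ ∷ ()) }
    }

-- Counting along the tree

-- Summation starts at the largest index because the labels of the children decrease as the site
-- increases.
sumDown : (ℕ → ℕ) → ℕ → ℕ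
sumDown f zero    = 0
sumDown f (suc n) = f n ℕ.+ sumDown f n

-- The numbers of descendants at depth m; nodesK m a belongs to K(a + 1) and
-- nodesJ m c b to J(c, b + 1).
nodesK : ℕ → ℕ → ℕ
nodesJ : ℕ → ℕ → ℕ → ℕ
nodesK zero    a = 1
nodesK (suc m) a = sumDown (nodesK m) (2 ℕ.+ a) ℕ.+ nodesJ m 0 0
nodesJ zero    c b = 1
nodesJ (suc m) c b =
  c ℕ.* nodesK m 0 ℕ.+ (nodesJ m c (suc b) ℕ.+ (sumDown (nodesJ m 0 ∘ suc) b ℕ.+ nodesJ m (suc b) 0))

-- Words as lists of naturals

⟦_⟧ : Word k n → List ℕ
⟦ w ⟧ = Vec.toList (Vec.map toℕ w)

-- In an increasing position vector every entry after the first is positive; this lets the first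
-- letter of the word be stripped off.
map-suc-positive : ∀ {m} (p : Vec (Fin (suc k)) m) → (∀ i → 0 < toℕ (lookup p i)) → ∃ λ q → p ≡ Vec.map Fin.suc q
map-suc-positive []            pos = [] , refl
map-suc-positive (Fin.zero ∷ p)    pos with () ← pos Fin.zero
map-suc-positive (Fin.suc i ∷ p)   pos with q , refl ← map-suc-positive p (pos ∘ Fin.suc) = i ∷ q , refl

increasing-map-suc⁻ : ∀ {m} (q : Vec (Fin k) m) → Increasing (Vec.map Fin.suc q) → Increasing q
increasing-map-suc⁻ q inc i j i<j =
  ≤-pred (subst₂ Fin._<_ (lookup-map i Fin.suc q) (lookup-map j Fin.suc q) (inc i j i<j))

increasing-map-suc⁺ : ∀ {m} (q : Vec (Fin k) m) → Increasing q → Increasing (Vec.map Fin.suc q)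
increasing-map-suc⁺ q inc i j i<j =
  subst₂ Fin._<_ (sym (lookup-map i Fin.suc q)) (sym (lookup-map j Fin.suc q)) (s≤s (inc i j i<j))

select : Word k n → ∀ {m} → Vec (Fin k) m → List ℕ
select w p = Vec.toList (Vec.map (toℕ ∘ lookup w) p)

select-suc : ∀ (x : Fin n) (w : Word k n) {m} (q : Vec (Fin k) m) → select (x ∷ w) (Vec.map Fin.suc q) ≡ select w q
select-suc x w []      = refl
select-suc x w (i ∷ q) = cong (toℕ (lookup w i) ∷_) (select-suc x w q)

select-⊆ : ∀ (w : Word k n) {m} (p : Vec (Fin k) m) → Increasing p → select w p ⊆ ⟦ w ⟧
select-⊆ w       []             inc = minimum _
select-⊆ (x ∷ w) (Fin.zero ∷ p) inc
  with q , refl ← map-suc-positive p (λ i → inc Fin.zero (Fin.suc i) (s≤s z≤n))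
  = refl ∷ subst (_⊆ ⟦ w ⟧) (sym (select-suc x w q)) (select-⊆ w q (increasing-map-suc⁻ q λ i j i<j → inc (Fin.suc i) (Fin.suc j) (s≤s i<j)))
select-⊆ (x ∷ w) p@(Fin.suc _ ∷ p′) inc
  with q , eq ← map-suc-positive p (λ { Fin.zero → s≤s z≤n ; (Fin.suc i) → ≤-trans (s≤s z≤n) (inc Fin.zero (Fin.suc i) (s≤s z≤n)) })
  = toℕ x ∷ʳ subst (_⊆ ⟦ w ⟧) (sym (trans (cong (select (x ∷ w)) eq) (select-suc x w q)))
      (select-⊆ w q (increasing-map-suc⁻ q (subst Increasing eq inc)))

-- A sublist derivation marks each letter as kept or skipped; the indices of the kept ones are the
-- positions.
⊆-select : ∀ (w : Word k n) {ys} → ys ⊆ ⟦ w ⟧ →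
  ∃ λ (p : Vec (Fin k) (length ys)) → Increasing p × (∀ i → toℕ (lookup w (lookup p i)) ≡ List.lookup ys i)
⊆-select []      []         = [] , (λ ()) , λ ()
⊆-select (x ∷ w) (_ ∷ʳ s) with p , inc , eq ← ⊆-select w s =
  Vec.map Fin.suc p , increasing-map-suc⁺ p inc ,
  λ i → trans (cong (toℕ ∘ lookup (x ∷ w)) (lookup-map i Fin.suc p)) (eq i)
⊆-select (x ∷ w) (refl ∷ s) with p , inc , eq ← ⊆-select w s =
  Fin.zero ∷ Vec.map Fin.suc p ,
  (λ { Fin.zero (Fin.suc j) _ → subst (0 <_) (cong toℕ (sym (lookup-map j Fin.suc p))) (s≤s z≤n)
     ; (Fin.suc i) (Fin.suc j) (s≤s i<j) → increasing-map-suc⁺ p inc i j i<j }) ,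
  λ { Fin.zero → refl ; (Fin.suc i) → trans (cong (toℕ ∘ lookup (x ∷ w)) (lookup-map i Fin.suc p)) (eq i) }

-- Occurrences of patterns of length four

module _ (s₀ s₁ s₂ s₃ : Fin 4) where

  -- The ranks start at 0, one-line notation at 1. For closed ranks this reduces to the literal
  -- pattern, so one argument serves all three members of `T`.
  pattern₄ : Pattern
  pattern₄ = suc (toℕ s₀) ∷ suc (toℕ s₁) ∷ suc (toℕ s₂) ∷ suc (toℕ s₃) ∷ []

  private
    s : Vec (Fin 4) 4
    s = s₀ ∷ s₁ ∷ s₂ ∷ s₃ ∷ []

    lookup-pattern : ∀ i → List.lookup pattern₄ i ≡ suc (toℕ (lookup s i))
    lookup-pattern 0F = refl
    lookup-pattern 1F = refl
    lookup-pattern 2F = refl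
    lookup-pattern 3F = refl

  module _ {a b c d : ℕ} (a<b : a < b) (b<c : b < c) (c<d : c < d) where

    private
      value : Fin 4 → ℕ
      value = lookup (a ∷ b ∷ c ∷ d ∷ [])

      value-mono : ∀ {i j} → i Fin.< j → value i < value j
      value-mono {0F} {1F} _ = a<b
      value-mono {0F} {2F} _ = <-trans a<b b<c
      value-mono {0F} {3F} _ = <-trans a<b (<-trans b<c c<d)
      value-mono {1F} {2F} _ = b<c
      value-mono {1F} {3F} _ = <-trans b<c c<d
      value-mono {2F} {3F} _ = c<d
      value-mono {1F} {1F} (s≤s ())
      value-mono {2F} {1F} (s≤s ())
      value-mono {2F} {2F} (s≤s (s≤s ()))
      value-mono {3F} {1F} (s≤s ())
      value-mono {3F} {2F} (s≤s (s≤s ()))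
      value-mono {3F} {3F} (s≤s (s≤s (s≤s ())))

      value-cancel : ∀ {i j} → value i < value j → i Fin.< j
      value-cancel {i} {j} v<v with i Fin.<? j
      ... | yes i<j = i<j
      ... | no  i≮j with ℕ.m≤n⇒m<n∨m≡n (ℕ.≮⇒≥ i≮j)
      ...   | inj₁ j<i = ⊥-elim (ℕ.<-asym v<v (value-mono j<i))
      ...   | inj₂ j≡i = ⊥-elim (ℕ.<-irrefl (cong value (sym (Fin.toℕ-injective j≡i))) v<v)

      values : List ℕ
      values = value s₀ ∷ value s₁ ∷ value s₂ ∷ value s₃ ∷ []

      lookup-values : ∀ i → List.lookup values i ≡ value (lookup s i)
      lookup-values 0F = refl
      lookup-values 1F = refl
      lookup-values 2F = refl
      lookup-values 3F = refl

    contains-values : ∀ (π : Word n n) → values ⊆ ⟦ π ⟧ → Contains π pattern₄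
    contains-values π sub with p , inc , eq ← ⊆-select π sub = p , inc , λ i j → mk⇔
      (λ i<j → subst₂ _<_ (sym (value≡ i)) (sym (value≡ j))
                 (value-mono (≤-pred (subst₂ _<_ (lookup-pattern i) (lookup-pattern j) i<j))))
      (λ i<j → subst₂ _<_ (sym (lookup-pattern i)) (sym (lookup-pattern j))
                 (s≤s (value-cancel (subst₂ _<_ (value≡ i) (value≡ j) i<j))))
      where
      value≡ : ∀ i → toℕ (lookup π (lookup p i)) ≡ value (lookup s i)
      value≡ i = trans (eq i) (lookup-values i)

-- Permutations built by prepending a letter

prepend : Word n n → Fin (suc n) → Word (suc n) (suc n)
prepend π v = v ∷ Vec.map (punchIn v) π

toℕ-punchIn : ∀ (v : Fin (suc n)) i → toℕ (punchIn v i) ≡ up (toℕ v) (toℕ i)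
toℕ-punchIn Fin.zero    i           = refl
toℕ-punchIn (Fin.suc v) Fin.zero    = refl
toℕ-punchIn (Fin.suc v) (Fin.suc i) = cong suc (toℕ-punchIn v i)

⟦prepend⟧ : ∀ (π : Word n n) v → ⟦ prepend π v ⟧ ≡ toℕ v ◂ ⟦ π ⟧
⟦prepend⟧ π v = cong (toℕ v ∷_) (lemma π)
  where
  lemma : ∀ (w : Word k _) → ⟦ Vec.map (punchIn v) w ⟧ ≡ List.map (up (toℕ v)) ⟦ w ⟧
  lemma []      = refl
  lemma (i ∷ w) = cong₂ _∷_ (toℕ-punchIn v i) (lemma w)

map-punchIn-injective : ∀ (v : Fin (suc n)) {w w′ : Word k n} → Vec.map (punchIn v) w ≡ Vec.map (punchIn v) w′ → w ≡ w′
map-punchIn-injective v {[]}    {[]}     eq = refl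
map-punchIn-injective v {i ∷ w} {j ∷ w′} eq with p , q ← ∷-injective eq =
  cong₂ _∷_ (Fin.punchIn-injective v i j p) (map-punchIn-injective v q)

prepend-injective : ∀ {π π′ : Word n n} {v v′} → prepend π v ≡ prepend π′ v′ → π ≡ π′ × v ≡ v′
prepend-injective {v = v} eq with refl , q ← ∷-injective eq = map-punchIn-injective v q , refl

isPermutation-prepend : ∀ {π : Word n n} v → IsPermutation π → IsPermutation (prepend π v)
isPermutation-prepend {n} {π} v (inj , sur) = inj′ , strictlySurjective⇒surjective sur′
  where
  inj′ : Injective _≡_ _≡_ (lookup (prepend π v))
  inj′ {Fin.zero}  {Fin.zero}  eq = refl
  inj′ {Fin.zero}  {Fin.suc j} eq =
    ⊥-elim (Fin.punchInᵢ≢i v (lookup π j) (sym (trans eq (lookup-map j (punchIn v) π))))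
  inj′ {Fin.suc i} {Fin.zero}  eq =
    ⊥-elim (Fin.punchInᵢ≢i v (lookup π i) (trans (sym (lookup-map i (punchIn v) π)) eq))
  inj′ {Fin.suc i} {Fin.suc j} eq = cong Fin.suc (inj (Fin.punchIn-injective v _ _
    (trans (sym (lookup-map i (punchIn v) π)) (trans eq (lookup-map j (punchIn v) π)))))

  sur′ : ∀ y → ∃ λ i → lookup (prepend π v) i ≡ y
  sur′ y with v Fin.≟ y
  ... | yes v≡y = Fin.zero , v≡y
  ... | no  v≢y with i , eq ← surjective⇒strictlySurjective sur (punchOut v≢y) =
    Fin.suc i , trans (lookup-map i (punchIn v) π) (trans (cong (punchIn v) eq) (Fin.punchIn-punchOut v≢y))

map-punchIn-cover : ∀ (v : Fin (suc n)) (w : Word k (suc n)) → (∀ i → v ≢ lookup w i) → ∃ λ w′ → w ≡ Vec.map (punchIn v) w′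
map-punchIn-cover v []      v∉ = [] , refl
map-punchIn-cover v (y ∷ w) v∉ with w′ , refl ← map-punchIn-cover v w (v∉ ∘ Fin.suc) =
  punchOut (v∉ Fin.zero) ∷ w′ , cong (_∷ Vec.map (punchIn v) w′) (sym (Fin.punchIn-punchOut (v∉ Fin.zero)))

isPermutation-tail : ∀ {π : Word n n} {v} → IsPermutation (prepend π v) → IsPermutation π
isPermutation-tail {n} {π} {v} (inj , sur) = inj′ , strictlySurjective⇒surjective sur′
  where
  inj′ : Injective _≡_ _≡_ (lookup π)
  inj′ {i} {j} eq = Fin.suc-injective (inj (trans (lookup-map i (punchIn v) π)
    (trans (cong (punchIn v) eq) (sym (lookup-map j (punchIn v) π)))))

  sur′ : ∀ y → ∃ λ i → lookup π i ≡ y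
  sur′ y with surjective⇒strictlySurjective sur (punchIn v y)
  ... | Fin.zero  , eq = ⊥-elim (Fin.punchInᵢ≢i v y (sym eq))
  ... | Fin.suc i , eq = i , Fin.punchIn-injective v _ _ (trans (sym (lookup-map i (punchIn v) π)) eq)

prepend-cover : ∀ (π : Word (suc n) (suc n)) → IsPermutation π → ∃₂ λ π′ v → π ≡ prepend π′ v × IsPermutation π′
prepend-cover (v ∷ w) perm@(inj , _)
  with w′ , refl ← map-punchIn-cover v w (λ i eq → Fin.0≢1+n (inj {Fin.zero} {Fin.suc i} eq))
  = w′ , v , refl , isPermutation-tail perm

-- Finite sums of naturals

sum-filter : ∀ {A : Set} {P : A → Set} (P? : ∀ a → Dec (P a)) (f : A → ℕ) as →
  sum (List.map f (List.filter P? as)) ≡ sum (List.map (λ a → if does (P? a) then f a else 0) as)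
sum-filter P? f []       = refl
sum-filter P? f (a ∷ as) with does (P? a)
... | true  = cong (f a ℕ.+_) (sum-filter P? f as)
... | false = sum-filter P? f as

sum-cartesianProductWith : ∀ {A B D : Set} (f : D → ℕ) (g : A → B → D) as bs →
  sum (List.map f (List.cartesianProductWith g as bs)) ≡ sum (List.map (λ a → sum (List.map (f ∘ g a) bs)) as)
sum-cartesianProductWith f g []       bs = refl
sum-cartesianProductWith f g (a ∷ as) bs = begin
  sum (List.map f (List.map (g a) bs List.++ List.cartesianProductWith g as bs))
    ≡⟨ cong sum (List.map-++ f (List.map (g a) bs) _) ⟩
  sum (List.map f (List.map (g a) bs) List.++ List.map f (List.cartesianProductWith g as bs))
    ≡⟨ sum-++ (List.map f (List.map (g a) bs)) _ ⟩
  sum (List.map f (List.map (g a) bs)) ℕ.+ sum (List.map f (List.cartesianProductWith g as bs))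
    ≡⟨ cong₂ ℕ._+_ (cong sum (sym (List.map-∘ bs))) (sum-cartesianProductWith f g as bs) ⟩
  sum (List.map (f ∘ g a) bs) ℕ.+ sum (List.map (λ a → sum (List.map (f ∘ g a) bs)) as)
    ∎
  where open ≡-Reasoning

length≡∑ : ∀ {A : Set} (xs : List A) → length xs ≡ sum (List.map (λ _ → 1) xs)
length≡∑ []       = refl
length≡∑ (_ ∷ xs) = cong suc (length≡∑ xs)

sumUp : (ℕ → ℕ) → ℕ → ℕ
sumUp f zero    = 0
sumUp f (suc n) = f 0 ℕ.+ sumUp (f ∘ suc) n

sumUp-+ : ∀ f p q → sumUp f (p ℕ.+ q) ≡ sumUp f p ℕ.+ sumUp (f ∘ (p ℕ.+_)) q
sumUp-+ f zero    q = refl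
sumUp-+ f (suc p) q = trans (cong (f 0 ℕ.+_) (sumUp-+ (f ∘ suc) p q)) (sym (+-assoc (f 0) _ _))

sumUp-const : ∀ f p x → (∀ {i} → i < p → f i ≡ x) → sumUp f p ≡ p ℕ.* x
sumUp-const f zero    x f≡ = refl
sumUp-const f (suc p) x f≡ = cong₂ ℕ._+_ (f≡ (s≤s z≤n)) (sumUp-const (f ∘ suc) p x (f≡ ∘ s≤s))

sumUp-sumDown : ∀ f g p → (∀ i j → i ℕ.+ suc j ≡ p → f i ≡ g j) → sumUp f p ≡ sumDown g p
sumUp-sumDown f g zero    f≡g = refl
sumUp-sumDown f g (suc p) f≡g =
  cong₂ ℕ._+_ (f≡g 0 p refl) (sumUp-sumDown (f ∘ suc) g p λ i j eq → f≡g (suc i) j (cong suc eq))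

sum-tabulate : ∀ n (h : Fin n → ℕ) f → (∀ v → h v ≡ f (toℕ v)) → sum (List.tabulate h) ≡ sumUp f n
sum-tabulate zero    h f h≡f = refl
sum-tabulate (suc n) h f h≡f =
  cong₂ ℕ._+_ (h≡f Fin.zero) (sum-tabulate n (h ∘ Fin.suc) (f ∘ suc) (h≡f ∘ Fin.suc))

-- Makes a function of sites total on ℕ, so that sums over sites can be cut at arbitrary points
-- without casts. The default 0 lies outside every range summed over.
extend : (Fin n → ℕ) → ℕ → ℕ
extend {n} h i with i ℕ.<? n
... | yes i<n = h (fromℕ< i<n)
... | no  _   = 0

extend-< : ∀ (h : Fin n → ℕ) {i} (i<n : i < n) → extend h i ≡ h (fromℕ< i<n)
extend-< {n} h {i} i<n with i ℕ.<? n
... | yes _   = refl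
... | no  i≮n = ⊥-elim (i≮n i<n)

extend-toℕ : ∀ (h : Fin n → ℕ) i → extend h (toℕ i) ≡ h i
extend-toℕ h i = trans (extend-< h (Fin.toℕ<n i)) (cong h (Fin.fromℕ<-toℕ i (Fin.toℕ<n i)))

-- Counting avoiders by their descendants

module Tree (T : List Pattern) where

  -- Words that contain a pattern weigh 0, so sums over children can run over all sites.
  weigh : (Word n n → ℕ) → Word n n → ℕ
  weigh f π = if does (avoids? π T) then f π else 0

  weigh-avoiding : ∀ (f : Word n n → ℕ) π → Avoids π T → weigh f π ≡ f π
  weigh-avoiding f π av = cong (λ b → if b then f π else 0) (dec-true (avoids? π T) av)

  weigh-containing : ∀ (f : Word n n → ℕ) π → ¬ Avoids π T → weigh f π ≡ 0
  weigh-containing f π ¬av = cong (λ b → if b then f π else 0) (dec-false (avoids? π T) ¬av)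

  descendants : ℕ → Word n n → ℕ
  descendants zero    π = 1
  descendants (suc m) π = sum (List.map (weigh (descendants m) ∘ prepend π) (List.allFin _))

  branch : ℕ → Word n n → ℕ → ℕ
  branch m π = extend (weigh (descendants m) ∘ prepend π)

  descendants-suc : ∀ m (π : Word n n) → descendants (suc m) π ≡ sumUp (branch m π) (suc n)
  descendants-suc {n} m π = trans
    (cong sum (List.map-tabulate (λ v → v) (weigh (descendants m) ∘ prepend π)))
    (sum-tabulate (suc n) _ (branch m π) (sym ∘ extend-toℕ (weigh (descendants m) ∘ prepend π)))

  module _ (hereditary : ∀ {n} {π : Word n n} {v} → Avoids (prepend π v) T → Avoids π T) where

    candidates : ∀ n → List (Word (suc n) (suc n))
    candidates n = List.cartesianProductWith prepend (S n T) (List.allFin (suc n))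

    -- Both lists are free of duplicates and have the same members; heredity puts the tail of an
    -- avoider into `S n T`.
    S-suc : ∀ n → S (suc n) T ↭ List.filter (λ π → avoids? π T) (candidates n)
    S-suc n = ∼bag⇒↭ (unique∧set⇒bag (S-unique (suc n) T)
      (filter⁺ _ (cartesianProductWith⁺ prepend prepend-injective (S-unique n T) (allFin⁺ (suc n))))
      (mk⇔ to from))
      where
      to : ∀ {π} → π ∈ S (suc n) T → π ∈ List.filter (λ π → avoids? π T) (candidates n)
      to {π} π∈ = decompose (Equivalence.to ∈-S π∈)
        where
        recompose : (∃₂ λ π′ v → π ≡ prepend π′ v × IsPermutation π′) → Avoids π T →
          π ∈ List.filter (λ π → avoids? π T) (candidates n)
        recompose (π′ , v , refl , perm) av = ∈-filter⁺ (λ π → avoids? π T)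
          (∈-cartesianProductWith⁺ prepend (Equivalence.from ∈-S (perm , hereditary av)) (∈-allFin v)) av
        decompose : IsPermutation π × Avoids π T → π ∈ List.filter (λ π → avoids? π T) (candidates n)
        decompose (perm , av) = recompose (prepend-cover π perm) av

      from : ∀ {π} → π ∈ List.filter (λ π → avoids? π T) (candidates n) → π ∈ S (suc n) T
      from {π} π∈ = filtered (∈-filter⁻ (λ π → avoids? π T) {xs = candidates n} π∈)
        where
        candidate : (∃₂ λ π′ v → π′ ∈ S n T × v ∈ List.allFin (suc n) × π ≡ prepend π′ v) → IsPermutation π
        candidate (π′ , v , π′∈ , _ , refl) = isPermutation-prepend v (proj₁ (Equivalence.to ∈-S π′∈))
        filtered : π ∈ candidates n × Avoids π T → π ∈ S (suc n) T
        filtered (π∈ , av) = Equivalence.from ∈-S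
          (candidate (∈-cartesianProductWith⁻ prepend (S n T) (List.allFin (suc n)) π∈) , av)

    -- Trades one letter of length for one generation. Starting at depth 0, where every word counts
    -- 1, iteration brings the count down to words of a fixed length.
    ∑-descendants : ∀ m n → sum (List.map (descendants m) (S (suc n) T)) ≡ sum (List.map (descendants (suc m)) (S n T))
    ∑-descendants m n = begin
      sum (List.map (descendants m) (S (suc n) T))
        ≡⟨ sum-↭ (↭.map⁺ (descendants m) (S-suc n)) ⟩
      sum (List.map (descendants m) (List.filter (λ π → avoids? π T) (candidates n)))
        ≡⟨ sum-filter (λ π → avoids? π T) (descendants m) (candidates n) ⟩
      sum (List.map (weigh (descendants m)) (candidates n))
        ≡⟨ sum-cartesianProductWith (weigh (descendants m)) prepend (S n T) (List.allFin (suc n)) ⟩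
      sum (List.map (descendants (suc m)) (S n T))
        ∎
      where open ≡-Reasoning

    ∑-descendants-S : ∀ m n → sum (List.map (descendants m) (S (n ℕ.+ k) T)) ≡ sum (List.map (descendants (n ℕ.+ m)) (S k T))
    ∑-descendants-S m zero    = refl
    ∑-descendants-S {k} m (suc n) = trans (∑-descendants m (n ℕ.+ k))
      (trans (∑-descendants-S (suc m) n) (cong (λ l → sum (List.map (descendants l) (S k T))) (+-suc n m)))

-- The generating tree of `T`

T : List Pattern
T = (1 ∷ 3 ∷ 2 ∷ 4 ∷ []) ∷ (1 ∷ 4 ∷ 3 ∷ 2 ∷ []) ∷ (3 ∷ 1 ∷ 4 ∷ 2 ∷ []) ∷ []

open Tree T

avoids⇒avoiding : ∀ (π : Word n n) → Avoids π T → Avoiding ⟦ π ⟧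
avoids⇒avoiding π (¬1324 ∷ ¬1432 ∷ ¬3142 ∷ []) = record
  { no-1324 = λ a<b b<c c<d s → ¬1324 (contains-values 0F 2F 1F 3F a<b b<c c<d π s)
  ; no-1432 = λ a<b b<c c<d s → ¬1432 (contains-values 0F 3F 2F 1F a<b b<c c<d π s)
  ; no-3142 = λ a<b b<c c<d s → ¬3142 (contains-values 2F 0F 3F 1F a<b b<c c<d π s)
  }

avoiding⇒avoids : ∀ (π : Word n n) → Avoiding ⟦ π ⟧ → Avoids π T
avoiding⇒avoids π A = ¬1324 ∷ ¬1432 ∷ ¬3142 ∷ []
  where
  open Equivalence
  1<2 : 1 < 2
  1<2 = s≤s (s≤s z≤n)
  2<3 : 2 < 3
  2<3 = s≤s 1<2
  3<4 : 3 < 4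
  3<4 = s≤s 2<3
  ¬1324 : ¬ Contains π (1 ∷ 3 ∷ 2 ∷ 4 ∷ [])
  ¬1324 (p@(_ ∷ _ ∷ _ ∷ _ ∷ []) , inc , iso) =
    no-1324 A (to (iso 0F 2F) 1<2) (to (iso 2F 1F) 2<3) (to (iso 1F 3F) 3<4) (select-⊆ π p inc)
  ¬1432 : ¬ Contains π (1 ∷ 4 ∷ 3 ∷ 2 ∷ [])
  ¬1432 (p@(_ ∷ _ ∷ _ ∷ _ ∷ []) , inc , iso) =
    no-1432 A (to (iso 0F 3F) 1<2) (to (iso 3F 2F) 2<3) (to (iso 2F 1F) 3<4) (select-⊆ π p inc)
  ¬3142 : ¬ Contains π (3 ∷ 1 ∷ 4 ∷ 2 ∷ [])
  ¬3142 (p@(_ ∷ _ ∷ _ ∷ _ ∷ []) , inc , iso) =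
    no-3142 A (to (iso 1F 3F) 1<2) (to (iso 3F 0F) 2<3) (to (iso 0F 2F) 3<4) (select-⊆ π p inc)

avoids-tail : ∀ {π : Word n n} {v} → Avoids (prepend π v) T → Avoids π T
avoids-tail {π = π} {v} av =
  avoiding⇒avoids π (avoiding-tail (subst Avoiding (⟦prepend⟧ π v) (avoids⇒avoiding (prepend π v) av)))

length-S : ∀ n → length (S (suc n) T) ≡ descendants n (Fin.zero ∷ [])
length-S n = begin
  length (S (suc n) T)                              ≡⟨ length≡∑ (S (suc n) T) ⟩
  sum (List.map (descendants 0) (S (suc n) T))      ≡⟨ cong (λ l → sum (List.map (descendants 0) (S l T))) (ℕ.+-comm n 1) ⟨
  sum (List.map (descendants 0) (S (n ℕ.+ 1) T))      ≡⟨ ∑-descendants-S avoids-tail 0 n ⟩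
  sum (List.map (descendants (n ℕ.+ 0)) (S 1 T))      ≡⟨ cong (λ l → sum (List.map (descendants l) (S 1 T))) (+-identityʳ n) ⟩
  -- `S 1 T` computes to the single word of length 1. The root is not the empty word, as both kinds
  -- of state require e < n.
  sum (List.map (descendants n) (S 1 T))            ≡⟨⟩
  descendants n (Fin.zero ∷ []) ℕ.+ 0                 ≡⟨ +-identityʳ _ ⟩
  descendants n (Fin.zero ∷ [])                     ∎
  where open ≡-Reasoning

module _ {n : ℕ} (m : ℕ) (π : Word n n) (A : Avoiding ⟦ π ⟧) where

  private
    child : ∀ {i} → i < suc n → Word (suc n) (suc n)
    child i≤n = prepend π (fromℕ< i≤n)

    ⟦child⟧ : ∀ {i} (i≤n : i < suc n) → ⟦ child i≤n ⟧ ≡ i ◂ ⟦ π ⟧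
    ⟦child⟧ i≤n = trans (⟦prepend⟧ π (fromℕ< i≤n)) (cong (_◂ ⟦ π ⟧) (Fin.toℕ-fromℕ< i≤n))

  -- `P` is the state of the child. The tree rules establish it for the list `i ◂ ⟦ π ⟧`, the
  -- recursive count wants it for a word; the transport is done here once for all rules.
  branch-active : ∀ {i k} (P : List ℕ → Set) → i ≤ n → Active ⟦ π ⟧ i → P (i ◂ ⟦ π ⟧) →
    (∀ {π′} → Avoiding ⟦ π′ ⟧ → P ⟦ π′ ⟧ → descendants m π′ ≡ k) → branch m π i ≡ k
  branch-active {i} {k} P i≤n V p rec = begin
    branch m π i                            ≡⟨ extend-< (weigh (descendants m) ∘ prepend π) (s≤s i≤n) ⟩
    weigh (descendants m) (child (s≤s i≤n)) ≡⟨ weigh-avoiding (descendants m) (child (s≤s i≤n)) (avoiding⇒avoids (child (s≤s i≤n)) A′) ⟩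
    descendants m (child (s≤s i≤n))         ≡⟨ rec A′ (subst P (sym (⟦child⟧ (s≤s i≤n))) p) ⟩
    k                                       ∎
    where
    open ≡-Reasoning
    A′ : Avoiding ⟦ child (s≤s i≤n) ⟧
    A′ = subst Avoiding (sym (⟦child⟧ (s≤s i≤n))) (avoiding-◂ A V)

  branch-inactive : ∀ {i} → i ≤ n → ¬ Active ⟦ π ⟧ i → branch m π i ≡ 0
  branch-inactive {i} i≤n ¬V = trans
    (extend-< (weigh (descendants m) ∘ prepend π) (s≤s i≤n))
    (weigh-containing (descendants m) (child (s≤s i≤n)) λ av →
      ¬V (avoiding-active (subst Avoiding (⟦child⟧ (s≤s i≤n)) (avoids⇒avoiding (child (s≤s i≤n)) av))))

-- In both proofs the sites 0, …, n are split into the blocks on which the child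
-- node is given by a uniform rule.
descendants-J : ∀ m (π : Word n n) {d e c b} → Avoiding ⟦ π ⟧ → StateJ d e n ⟦ π ⟧ →
  e ≡ d ℕ.+ c → n ≡ e ℕ.+ suc b → descendants m π ≡ nodesJ m c b
descendants-K : ∀ m (π : Word n n) {d e a} → Avoiding ⟦ π ⟧ → StateK d e n ⟦ π ⟧ →
  e ≡ suc (d ℕ.+ a) → descendants m π ≡ nodesK m a

descendants-J zero    π A st e≡ n≡ = refl
descendants-J {n} (suc m) π {d} {e} {c} {b} A st refl n≡ = begin
  descendants (suc m) π
    ≡⟨ descendants-suc m π ⟩
  sumUp f (suc n)
    -- The blocks: d inactive sites, c low sites, the site e, the b sites inside the high block, the
    -- site n.
    ≡⟨ cong (sumUp f) suc-n≡ ⟩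
  sumUp f (d ℕ.+ (c ℕ.+ suc (b ℕ.+ 1)))
    ≡⟨ sumUp-+ f d _ ⟩
  sumUp f d ℕ.+ sumUp (f ∘ (d ℕ.+_)) (c ℕ.+ suc (b ℕ.+ 1))
    ≡⟨ cong (sumUp f d ℕ.+_) (sumUp-+ (f ∘ (d ℕ.+_)) c _) ⟩
  sumUp f d ℕ.+ (sumUp (f ∘ (d ℕ.+_)) c ℕ.+ (f (d ℕ.+ (c ℕ.+ 0)) ℕ.+ sumUp (λ i → f (d ℕ.+ (c ℕ.+ suc i))) (b ℕ.+ 1)))
    ≡⟨ cong (λ u → sumUp f d ℕ.+ (sumUp (f ∘ (d ℕ.+_)) c ℕ.+ (f (d ℕ.+ (c ℕ.+ 0)) ℕ.+ u))) (sumUp-+ (λ i → f (d ℕ.+ (c ℕ.+ suc i))) b 1) ⟩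
  sumUp f d ℕ.+ (sumUp (f ∘ (d ℕ.+_)) c ℕ.+ (f (d ℕ.+ (c ℕ.+ 0)) ℕ.+ (sumUp (λ i → f (d ℕ.+ (c ℕ.+ suc i))) b ℕ.+ (f (d ℕ.+ (c ℕ.+ suc (b ℕ.+ 0))) ℕ.+ 0))))
    ≡⟨ cong₂ ℕ._+_ (trans (sumUp-const f d 0 inactives) (ℕ.*-zeroʳ d))
         (cong₂ ℕ._+_ (sumUp-const (f ∘ (d ℕ.+_)) c (nodesK m 0) lows)
           (cong₂ ℕ._+_ middle
             (cong₂ ℕ._+_ (sumUp-sumDown (λ i → f (d ℕ.+ (c ℕ.+ suc i))) (nodesJ m 0 ∘ suc) b highs)
               (trans (+-identityʳ _) top)))) ⟩
  nodesJ (suc m) c b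
    ∎
  where
  open ≡-Reasoning
  open StateJ st
  f : ℕ → ℕ
  f = branch m π

  suc-n≡ : suc n ≡ d ℕ.+ (c ℕ.+ suc (b ℕ.+ 1))
  suc-n≡ = trans (cong suc n≡)
    (ℕ-Solver.solve 3 (λ d c b → con 1 :+ ((d :+ c) :+ (con 1 :+ b)) := d :+ (c :+ (con 1 :+ (b :+ con 1)))) refl d c b)
    where open ℕ-Solver using (con; _:+_; _:=_)

  inactives : ∀ {i} → i < d → f i ≡ 0
  inactives i<d = branch-inactive m π A (≤-trans (ℕ.<⇒≤ i<d) (≤-trans d≤e (ℕ.<⇒≤ e<n))) (inactive i<d)

  lows : ∀ {i} → i < c → f (d ℕ.+ i) ≡ nodesK m 0
  lows {i} i<c =
    branch-active m π A (StateK (d ℕ.+ i) (suc (d ℕ.+ i)) (suc n)) v≤n (active (m≤m+n d i) v≤n) (J-low st (m≤m+n d i) v<e)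
      (λ A′ st′ → descendants-K m _ A′ st′ (cong suc (sym (+-identityʳ (d ℕ.+ i)))))
    where
    v<e : d ℕ.+ i < d ℕ.+ c
    v<e = ℕ.+-monoʳ-< d i<c
    v≤n : d ℕ.+ i ≤ n
    v≤n = ℕ.<⇒≤ (<-trans v<e e<n)

  middle : f (d ℕ.+ (c ℕ.+ 0)) ≡ nodesJ m c (suc b)
  middle = trans (cong (λ u → f (d ℕ.+ u)) (+-identityʳ c))
    (branch-active m π A (StateJ d (d ℕ.+ c) (suc n)) (ℕ.<⇒≤ e<n) (active d≤e (ℕ.<⇒≤ e<n)) (J-middle st)
      (λ A′ st′ → descendants-J m _ A′ st′ refl (trans (cong suc n≡) (sym (+-suc (d ℕ.+ c) (suc b))))))

  highs : ∀ i j → i ℕ.+ suc j ≡ b → f (d ℕ.+ (c ℕ.+ suc i)) ≡ nodesJ m 0 (suc j)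
  highs i j refl =
    branch-active m π A (StateJ v v (suc n)) v≤n (active (m≤m+n d (c ℕ.+ suc i)) v≤n) (J-high st e<v v<n)
      (λ A′ st′ → descendants-J m _ A′ st′ (sym (+-identityʳ _)) (trans (cong suc n≡v) (sym (+-suc _ (suc j)))))
    where
    open ℕ-Solver using (con; _:+_; _:=_)
    v : ℕ
    v = d ℕ.+ (c ℕ.+ suc i)
    n≡v : n ≡ d ℕ.+ (c ℕ.+ suc i) ℕ.+ suc j
    n≡v = trans n≡ (ℕ-Solver.solve 4 (λ d c i j → (d :+ c) :+ (con 1 :+ (i :+ (con 1 :+ j))) := (d :+ (c :+ (con 1 :+ i))) :+ (con 1 :+ j)) refl d c i j)
    e<v : d ℕ.+ c < d ℕ.+ (c ℕ.+ suc i)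
    e<v = ℕ.+-monoʳ-< d (ℕ.m<m+n c (s≤s z≤n))
    v<n : d ℕ.+ (c ℕ.+ suc i) < n
    v<n = subst (d ℕ.+ (c ℕ.+ suc i) <_) (sym n≡v) (ℕ.m<m+n _ (s≤s z≤n))
    v≤n : d ℕ.+ (c ℕ.+ suc i) ≤ n
    v≤n = ℕ.<⇒≤ v<n

  top : f (d ℕ.+ (c ℕ.+ suc (b ℕ.+ 0))) ≡ nodesJ m (suc b) 0
  top = trans (cong f v≡n) (branch-active m π A (StateJ (d ℕ.+ c) n (suc n)) ≤-refl (active (≤-trans d≤e (ℕ.<⇒≤ e<n)) ≤-refl) (J-top st)
    (λ A′ st′ → descendants-J m _ A′ st′ n≡ (sym (ℕ.+-comm n 1))))
    where
    v≡n : d ℕ.+ (c ℕ.+ suc (b ℕ.+ 0)) ≡ n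
    v≡n = trans (cong (λ u → d ℕ.+ (c ℕ.+ suc u)) (+-identityʳ b)) (trans (sym (+-assoc d c (suc b))) (sym n≡))

descendants-K zero    π A st e≡ = refl
descendants-K {n} (suc m) π {d} {e} {a} A st refl = begin
  descendants (suc m) π
    ≡⟨ descendants-suc m π ⟩
  sumUp f (suc n)
    ≡⟨ cong (sumUp f) suc-n≡ ⟩
  sumUp f (d ℕ.+ ((2 ℕ.+ a) ℕ.+ (r ℕ.+ 1)))
    ≡⟨ sumUp-+ f d _ ⟩
  sumUp f d ℕ.+ sumUp (f ∘ (d ℕ.+_)) ((2 ℕ.+ a) ℕ.+ (r ℕ.+ 1))
    ≡⟨ cong (sumUp f d ℕ.+_) (sumUp-+ (f ∘ (d ℕ.+_)) (2 ℕ.+ a) _) ⟩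
  sumUp f d ℕ.+ (sumUp (f ∘ (d ℕ.+_)) (2 ℕ.+ a) ℕ.+ sumUp (λ i → f (d ℕ.+ ((2 ℕ.+ a) ℕ.+ i))) (r ℕ.+ 1))
    ≡⟨ cong (λ u → sumUp f d ℕ.+ (sumUp (f ∘ (d ℕ.+_)) (2 ℕ.+ a) ℕ.+ u)) (sumUp-+ (λ i → f (d ℕ.+ ((2 ℕ.+ a) ℕ.+ i))) r 1) ⟩
  sumUp f d ℕ.+ (sumUp (f ∘ (d ℕ.+_)) (2 ℕ.+ a) ℕ.+ (sumUp (λ i → f (d ℕ.+ ((2 ℕ.+ a) ℕ.+ i))) r ℕ.+ (f (d ℕ.+ ((2 ℕ.+ a) ℕ.+ (r ℕ.+ 0))) ℕ.+ 0)))
    ≡⟨ cong₂ ℕ._+_ (trans (sumUp-const f d 0 inactives) (ℕ.*-zeroʳ d))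
         (cong₂ ℕ._+_ (sumUp-sumDown (f ∘ (d ℕ.+_)) (nodesK m) (2 ℕ.+ a) lows)
           (cong₂ ℕ._+_ (trans (sumUp-const (λ i → f (d ℕ.+ ((2 ℕ.+ a) ℕ.+ i))) r 0 gaps) (ℕ.*-zeroʳ r))
             (trans (+-identityʳ _) top))) ⟩
  nodesK (suc m) a
    ∎
  where
  open ≡-Reasoning
  open StateK st
  open ℕ-Solver using (con; _:+_; _:=_)
  f : ℕ → ℕ
  f = branch m π

  -- The number of inactive sites strictly between e and n.
  r : ℕ
  r = n ℕ.∸ suc (suc (d ℕ.+ a))

  n≡ : n ≡ suc (suc (d ℕ.+ a)) ℕ.+ r
  n≡ = sym (ℕ.m+[n∸m]≡n e<n)

  suc-n≡ : suc n ≡ d ℕ.+ ((2 ℕ.+ a) ℕ.+ (r ℕ.+ 1))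
  suc-n≡ = trans (cong suc n≡)
    (ℕ-Solver.solve 3 (λ d a r → con 1 :+ (con 2 :+ (d :+ a) :+ r) := d :+ (con 2 :+ a :+ (r :+ con 1))) refl d a r)

  inactives : ∀ {i} → i < d → f i ≡ 0
  inactives i<d = branch-inactive m π A (≤-trans (ℕ.<⇒≤ i<d) (≤-trans d≤e (ℕ.<⇒≤ e<n))) (inactive i<d)

  lows : ∀ i j → i ℕ.+ suc j ≡ 2 ℕ.+ a → f (d ℕ.+ i) ≡ nodesK m j
  lows i j eq =
    branch-active m π A (StateK (d ℕ.+ i) (suc (suc (d ℕ.+ a))) (suc n)) (≤-trans v≤e (ℕ.<⇒≤ e<n)) (active (m≤m+n d i) v≤e) (K-low st (m≤m+n d i) v≤e)
      (λ A′ st′ → descendants-K m _ A′ st′ (cong suc e≡))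
    where
    i+j≡ : i ℕ.+ j ≡ suc a
    i+j≡ = ℕ.suc-injective (trans (sym (+-suc i j)) eq)
    e≡ : suc (d ℕ.+ a) ≡ d ℕ.+ i ℕ.+ j
    e≡ = trans (sym (+-suc d a)) (trans (cong (d ℕ.+_) (sym i+j≡)) (sym (+-assoc d i j)))
    v≤e : d ℕ.+ i ≤ suc (d ℕ.+ a)
    v≤e = subst (d ℕ.+ i ≤_) (sym e≡) (m≤m+n (d ℕ.+ i) j)

  gaps : ∀ {i} → i < r → f (d ℕ.+ ((2 ℕ.+ a) ℕ.+ i)) ≡ 0
  gaps {i} i<r = branch-inactive m π A (ℕ.<⇒≤ v<n) (inactive′ e<v v<n)
    where
    v≡ : d ℕ.+ ((2 ℕ.+ a) ℕ.+ i) ≡ suc (suc (d ℕ.+ a)) ℕ.+ i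
    v≡ = ℕ-Solver.solve 3 (λ d a i → d :+ (con 2 :+ a :+ i) := con 2 :+ (d :+ a) :+ i) refl d a i
    e<v : suc (d ℕ.+ a) < d ℕ.+ ((2 ℕ.+ a) ℕ.+ i)
    e<v = subst (suc (d ℕ.+ a) <_) (sym v≡) (m≤m+n (suc (suc (d ℕ.+ a))) i)
    v<n : d ℕ.+ ((2 ℕ.+ a) ℕ.+ i) < n
    v<n = subst₂ _<_ (sym v≡) (sym n≡) (ℕ.+-monoʳ-< (suc (suc (d ℕ.+ a))) i<r)

  top : f (d ℕ.+ ((2 ℕ.+ a) ℕ.+ (r ℕ.+ 0))) ≡ nodesJ m 0 0
  top = trans (cong f v≡n) (branch-active m π A (StateJ n n (suc n)) ≤-refl active-top (K-top st)
    (λ A′ st′ → descendants-J m _ A′ st′ (sym (+-identityʳ n)) (sym (ℕ.+-comm n 1))))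
    where
    v≡n : d ℕ.+ ((2 ℕ.+ a) ℕ.+ (r ℕ.+ 0)) ≡ n
    v≡n = trans (ℕ-Solver.solve 3 (λ d a i → d :+ (con 2 :+ a :+ (i :+ con 0)) := con 2 :+ (d :+ a) :+ i) refl d a r) (sym n≡)

length-S≡nodesJ : ∀ n → length (S (suc n) T) ≡ nodesJ n 0 0
length-S≡nodesJ n = trans (length-S n) (descendants-J n (Fin.zero ∷ []) avoiding-[0] state-[0] refl refl)
  where
  avoiding-[0] : Avoiding (0 ◂ [])
  avoiding-[0] = avoiding-◂
    (record { no-1324 = λ _ _ _ () ; no-1432 = λ _ _ _ () ; no-3142 = λ _ _ _ () })
    (active-[] 0)

-- The ring of power series

-- `ℚ./` cancels common factors, so the comparison is made between unnormalised fractions.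
+-/1 : ∀ i j → (i ℤ.+ j) ℚ./ 1 ≡ i ℚ./ 1 ℚ.+ j ℚ./ 1
+-/1 i j = ℚ.toℚᵘ-injective (begin
  ℚ.toℚᵘ ((i ℤ.+ j) ℚ./ 1)                  ≈⟨ ℚ.toℚᵘ-fromℚᵘ (mkℚᵘ (i ℤ.+ j) 0) ⟩
  mkℚᵘ (i ℤ.+ j) 0                          ≈⟨ *≡* (cong (ℤ._* + 1) (cong₂ ℤ._+_ (sym (ℤ.*-identityʳ i)) (sym (ℤ.*-identityʳ j)))) ⟩
  mkℚᵘ i 0 ℚᵘ.+ mkℚᵘ j 0                    ≈⟨ ℚᵘ.+-cong (ℚ.toℚᵘ-fromℚᵘ (mkℚᵘ i 0)) (ℚ.toℚᵘ-fromℚᵘ (mkℚᵘ j 0)) ⟨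
  ℚ.toℚᵘ (i ℚ./ 1) ℚᵘ.+ ℚ.toℚᵘ (j ℚ./ 1)    ≈⟨ ℚ.toℚᵘ-homo-+ (i ℚ./ 1) (j ℚ./ 1) ⟨
  ℚ.toℚᵘ (i ℚ./ 1 ℚ.+ j ℚ./ 1)              ∎)
  where open ℚᵘ.≃-Reasoning

*-/1 : ∀ i j → (i ℤ.* j) ℚ./ 1 ≡ (i ℚ./ 1) ℚ.* (j ℚ./ 1)
*-/1 i j = ℚ.toℚᵘ-injective (begin
  ℚ.toℚᵘ ((i ℤ.* j) ℚ./ 1)                  ≈⟨ ℚ.toℚᵘ-fromℚᵘ (mkℚᵘ (i ℤ.* j) 0) ⟩
  mkℚᵘ i 0 ℚᵘ.* mkℚᵘ j 0                    ≈⟨ ℚᵘ.*-cong (ℚ.toℚᵘ-fromℚᵘ (mkℚᵘ i 0)) (ℚ.toℚᵘ-fromℚᵘ (mkℚᵘ j 0)) ⟨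
  ℚ.toℚᵘ (i ℚ./ 1) ℚᵘ.* ℚ.toℚᵘ (j ℚ./ 1)    ≈⟨ ℚ.toℚᵘ-homo-* (i ℚ./ 1) (j ℚ./ 1) ⟨
  ℚ.toℚᵘ ((i ℚ./ 1) ℚ.* (j ℚ./ 1))              ∎)
  where open ℚᵘ.≃-Reasoning

neg-/1 : ∀ i → (ℤ.- i) ℚ./ 1 ≡ ℚ.- (i ℚ./ 1)
neg-/1 (+ zero)  = refl
neg-/1 (+ suc m) = refl
neg-/1 -[1+ m ]  = sym (⁻¹-involutive (+ suc m ℚ./ 1))

fromℕ-+ : ∀ m n → fromℕ (m ℕ.+ n) ≡ fromℕ m ℚ.+ fromℕ n
fromℕ-+ m n = +-/1 (+ m) (+ n)

fromℕ-* : ∀ m n → fromℕ (m ℕ.* n) ≡ fromℕ m ℚ.* fromℕ n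
fromℕ-* m n = trans (cong (ℚ._/ 1) (ℤ.pos-* m n)) (*-/1 (+ m) (+ n))

fromℕ-nonZero : ∀ m → ℚ.NonZero (fromℕ (suc m))
fromℕ-nonZero m = ℚ.pos⇒nonZero (fromℕ (suc m)) {{ℚ.normalize-pos (suc m) 1}}

infixl 6 _+_
infix  8 -_

_+_ : PowerSeries → PowerSeries → PowerSeries
(A + B) n = A n ℚ.+ B n

-_ : PowerSeries → PowerSeries
(- A) n = ℚ.- A n

shift : PowerSeries → PowerSeries
shift A = A ∘ suc

*-cong : ∀ {A A′ B B′} → A ≈ A′ → B ≈ B′ → A * B ≈ A′ * B′
*-cong A≈ B≈ n = sum-cong-≗ {suc n} λ i → cong₂ ℚ._*_ (A≈ (toℕ i)) (B≈ (n ∸ toℕ i))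

*-distribʳ-+ : ∀ A B D → (B + D) * A ≈ B * A + D * A
*-distribʳ-+ A B D n = trans
  (sum-cong-≗ {suc n} λ i → ℚ.*-distribʳ-+ (A (n ∸ toℕ i)) (B (toℕ i)) (D (toℕ i)))
  (∑-distrib-+ {suc n} (λ i → B (toℕ i) ℚ.* A (n ∸ toℕ i)) (λ i → D (toℕ i) ℚ.* A (n ∸ toℕ i)))

scale : ℚ → PowerSeries → PowerSeries
scale q A n = q ℚ.* A n

scale-*-assoc : ∀ q A B → scale q A * B ≈ scale q (A * B)
scale-*-assoc q A B n = trans
  (sum-cong-≗ {suc n} λ i → ℚ.*-assoc q (A (toℕ i)) (B (n ∸ toℕ i)))
  (sym (*-distribˡ-sum {suc n} q (λ i → A (toℕ i) ℚ.* B (n ∸ toℕ i))))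

-- Induction on the degree: peeling the first summand shows, definitionally, that `shift (A * B)` is
-- `scale (A 0) (shift B) + shift A * B`.
*-assoc : ∀ A B D → (A * B) * D ≈ A * (B * D)
*-assoc A B D zero = begin
  (A 0 ℚ.* B 0 ℚ.+ 0ℚ) ℚ.* D 0 ℚ.+ 0ℚ   ≡⟨ cong (λ u → u ℚ.* D 0 ℚ.+ 0ℚ) (ℚ.+-identityʳ (A 0 ℚ.* B 0)) ⟩
  A 0 ℚ.* B 0 ℚ.* D 0 ℚ.+ 0ℚ            ≡⟨ cong (ℚ._+ 0ℚ) (ℚ.*-assoc (A 0) (B 0) (D 0)) ⟩
  A 0 ℚ.* (B 0 ℚ.* D 0) ℚ.+ 0ℚ          ≡⟨ cong (λ u → A 0 ℚ.* u ℚ.+ 0ℚ) (ℚ.+-identityʳ (B 0 ℚ.* D 0)) ⟨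
  A 0 ℚ.* (B 0 ℚ.* D 0 ℚ.+ 0ℚ) ℚ.+ 0ℚ   ∎
  where open ≡-Reasoning
*-assoc A B D (suc n) = begin
  (A 0 ℚ.* B 0 ℚ.+ 0ℚ) ℚ.* D (suc n) ℚ.+ (shift (A * B) * D) n
    ≡⟨ cong₂ ℚ._+_ (cong (ℚ._* D (suc n)) (ℚ.+-identityʳ (A 0 ℚ.* B 0)))
         (*-distribʳ-+ D (scale (A 0) (shift B)) (shift A * B) n) ⟩
  A 0 ℚ.* B 0 ℚ.* D (suc n) ℚ.+ ((scale (A 0) (shift B) * D) n ℚ.+ (shift A * B * D) n)
    ≡⟨ cong₂ ℚ._+_ (ℚ.*-assoc (A 0) (B 0) (D (suc n)))
         (cong₂ ℚ._+_ (scale-*-assoc (A 0) (shift B) D n) (*-assoc (shift A) B D n)) ⟩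
  A 0 ℚ.* (B 0 ℚ.* D (suc n)) ℚ.+ (A 0 ℚ.* (shift B * D) n ℚ.+ (shift A * (B * D)) n)
    ≡⟨ ℚ.+-assoc (A 0 ℚ.* (B 0 ℚ.* D (suc n))) _ _ ⟨
  A 0 ℚ.* (B 0 ℚ.* D (suc n)) ℚ.+ A 0 ℚ.* (shift B * D) n ℚ.+ (shift A * (B * D)) n
    ≡⟨ cong (ℚ._+ (shift A * (B * D)) n) (ℚ.*-distribˡ-+ (A 0) (B 0 ℚ.* D (suc n)) ((shift B * D) n)) ⟨
  A 0 ℚ.* (B * D) (suc n) ℚ.+ (shift A * (B * D)) n
    ∎
  where open ≡-Reasoning

-- Peels the last summand, the mirror image of the definitional peeling of the first; commutativity
-- compares the two.
*-suc : ∀ A B n → (A * B) (suc n) ≡ (A * shift B) n ℚ.+ A (suc n) ℚ.* B 0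
*-suc A B zero = begin
  A 0 ℚ.* B 1 ℚ.+ (A 1 ℚ.* B 0 ℚ.+ 0ℚ)   ≡⟨ cong (A 0 ℚ.* B 1 ℚ.+_) (ℚ.+-identityʳ _) ⟩
  A 0 ℚ.* B 1 ℚ.+ A 1 ℚ.* B 0            ≡⟨ cong (ℚ._+ A 1 ℚ.* B 0) (ℚ.+-identityʳ (A 0 ℚ.* B 1)) ⟨
  A 0 ℚ.* B 1 ℚ.+ 0ℚ ℚ.+ A 1 ℚ.* B 0     ∎
  where open ≡-Reasoning
*-suc A B (suc n) =
  trans (cong (A 0 ℚ.* B (suc (suc n)) ℚ.+_) (*-suc (shift A) B n))
        (sym (ℚ.+-assoc (A 0 ℚ.* B (suc (suc n))) ((shift A * shift B) n) (A (suc (suc n)) ℚ.* B 0)))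

*-comm : ∀ A B → A * B ≈ B * A
*-comm A B zero    = cong (ℚ._+ 0ℚ) (ℚ.*-comm (A 0) (B 0))
*-comm A B (suc n) = begin
  A 0 ℚ.* B (suc n) ℚ.+ (shift A * B) n   ≡⟨ cong₂ ℚ._+_ (ℚ.*-comm (A 0) (B (suc n))) (*-comm (shift A) B n) ⟩
  B (suc n) ℚ.* A 0 ℚ.+ (B * shift A) n   ≡⟨ ℚ.+-comm (B (suc n) ℚ.* A 0) _ ⟩
  (B * shift A) n ℚ.+ B (suc n) ℚ.* A 0   ≡⟨ *-suc B A n ⟨
  (B * A) (suc n)                        ∎
  where open ≡-Reasoning

constant-* : ∀ m A n → (constant m * A) n ≡ fromℕ m ℚ.* A n
constant-* m A zero    = ℚ.+-identityʳ _
constant-* m A (suc n) = begin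
  fromℕ m ℚ.* A (suc n) ℚ.+ ∑ {suc n} (λ i → 0ℚ ℚ.* A (n ∸ toℕ i))
    ≡⟨ cong (fromℕ m ℚ.* A (suc n) ℚ.+_) (trans (sum-cong-≗ {suc n} λ i → ℚ.*-zeroˡ (A (n ∸ toℕ i))) (sum-replicate-zero (suc n))) ⟩
  fromℕ m ℚ.* A (suc n) ℚ.+ 0ℚ
    ≡⟨ ℚ.+-identityʳ _ ⟩
  fromℕ m ℚ.* A (suc n)
    ∎
  where open ≡-Reasoning

x-*-zero : ∀ A → (x * A) 0 ≡ 0ℚ
x-*-zero A = trans (ℚ.+-identityʳ _) (ℚ.*-zeroˡ (A 0))

x-*-suc : ∀ A n → (x * A) (suc n) ≡ A n
x-*-suc A n = begin
  0ℚ ℚ.* A (suc n) ℚ.+ (shift x * A) n   ≡⟨ cong₂ ℚ._+_ (ℚ.*-zeroˡ (A (suc n))) (*-cong {B = A} shift-x (λ _ → refl) n) ⟩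
  0ℚ ℚ.+ (constant 1 * A) n             ≡⟨ ℚ.+-identityˡ _ ⟩
  (constant 1 * A) n                    ≡⟨ constant-* 1 A n ⟩
  1ℚ ℚ.* A n                            ≡⟨ ℚ.*-identityˡ (A n) ⟩
  A n                                   ∎
  where
  open ≡-Reasoning
  shift-x : shift x ≈ constant 1
  shift-x zero    = refl
  shift-x (suc _) = refl

*-identityˡ : ∀ A → constant 1 * A ≈ A
*-identityˡ A n = trans (constant-* 1 A n) (ℚ.*-identityˡ (A n))

powerSeriesRing : CommutativeRing _ _
powerSeriesRing = record
  { Carrier = PowerSeries
  ; _≈_ = _≈_
  ; _+_ = _+_
  ; _*_ = _*_
  ; -_ = -_
  ; 0# = λ _ → 0ℚ
  ; 1# = constant 1
  ; isCommutativeRing = record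
    { isRing = record
      { +-isAbelianGroup = record
        { isGroup = record
          { isMonoid = record
            { isSemigroup = record
              { isMagma = record
                { isEquivalence = record
                  { refl = λ _ → refl
                  ; sym = λ p n → sym (p n)
                  ; trans = λ p q n → trans (p n) (q n)
                  }
                ; ∙-cong = λ p q n → cong₂ ℚ._+_ (p n) (q n)
                }
              ; assoc = λ A B D n → ℚ.+-assoc (A n) (B n) (D n)
              }
            ; identity = (λ A n → ℚ.+-identityˡ (A n)) , λ A n → ℚ.+-identityʳ (A n)
            }
          ; inverse = (λ A n → ℚ.+-inverseˡ (A n)) , λ A n → ℚ.+-inverseʳ (A n)
          ; ⁻¹-cong = λ p n → cong ℚ.-_ (p n)
          }
        ; comm = λ A B n → ℚ.+-comm (A n) (B n)
        }
      ; *-cong = *-cong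
      ; *-assoc = *-assoc
      ; *-identity = *-identityˡ , λ A n → trans (*-comm A (constant 1) n) (*-identityˡ A n)
      ; distrib =
          (λ A B D n → trans (*-comm A (B + D) n)
             (trans (*-distribʳ-+ A B D n) (cong₂ ℚ._+_ (*-comm B A n) (*-comm D A n))))
          , *-distribʳ-+
      }
    ; *-comm = *-comm
    }
  }

open CommutativeRing powerSeriesRing using (setoid; +-cong; -‿cong; +-congˡ; +-congʳ; *-congˡ; *-congʳ)
  renaming (refl to ≈-refl; sym to ≈-sym; trans to ≈-trans)
open import Algebra.Properties.Semiring.Exp (CommutativeRing.semiring powerSeriesRing) using (_^_)

-- Coefficients for the ring solver: integers compute and have decidable equality, and `con (+ m)`
-- denotes `constant m` on the nose.
constantℤ : ℤ → PowerSeries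
constantℤ (+ m)      = constant m
constantℤ -[1+ m ]   = - constant (suc m)

constantℤ-zero : ∀ i → constantℤ i 0 ≡ i ℚ./ 1
constantℤ-zero (+ m)    = refl
constantℤ-zero -[1+ m ] = refl

constantℤ-suc : ∀ i n → constantℤ i (suc n) ≡ 0ℚ
constantℤ-suc (+ m)    n = refl
constantℤ-suc -[1+ m ] n = refl

constantℤ-+ : ∀ i j → constantℤ (i ℤ.+ j) ≈ constantℤ i + constantℤ j
constantℤ-+ i j zero rewrite constantℤ-zero (i ℤ.+ j) | constantℤ-zero i | constantℤ-zero j = +-/1 i j
constantℤ-+ i j (suc n) rewrite constantℤ-suc (i ℤ.+ j) n | constantℤ-suc i n | constantℤ-suc j n = refl

constantℤ-neg : ∀ i → constantℤ (ℤ.- i) ≈ - constantℤ i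
constantℤ-neg i zero rewrite constantℤ-zero (ℤ.- i) | constantℤ-zero i = neg-/1 i
constantℤ-neg i (suc n) rewrite constantℤ-suc (ℤ.- i) n | constantℤ-suc i n = refl

constantℤ-*-coefficient : ∀ i A n → (constantℤ i * A) n ≡ (i ℚ./ 1) ℚ.* A n
constantℤ-*-coefficient (+ m)    A n = constant-* m A n
constantℤ-*-coefficient -[1+ m ] A n = begin
  (- constant (suc m) * A) n           ≡⟨ -‿distribˡ-* (constant (suc m)) A n ⟨
  ℚ.- (constant (suc m) * A) n         ≡⟨ cong ℚ.-_ (constant-* (suc m) A n) ⟩
  ℚ.- (fromℕ (suc m) ℚ.* A n)          ≡⟨ ℚ.neg-distribˡ-* (fromℕ (suc m)) (A n) ⟩
  (-[1+ m ] ℚ./ 1) ℚ.* A n               ∎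
  where
  open ≡-Reasoning
  open import Algebra.Properties.Ring (CommutativeRing.ring powerSeriesRing) using (-‿distribˡ-*)

constantℤ-* : ∀ i j → constantℤ (i ℤ.* j) ≈ constantℤ i * constantℤ j
constantℤ-* i j n = trans (lemma n) (sym (constantℤ-*-coefficient i (constantℤ j) n))
  where
  lemma : constantℤ (i ℤ.* j) ≈ scale (i ℚ./ 1) (constantℤ j)
  lemma zero rewrite constantℤ-zero (i ℤ.* j) | constantℤ-zero j = *-/1 i j
  lemma (suc n) rewrite constantℤ-suc (i ℤ.* j) n | constantℤ-suc j n = sym (ℚ.*-zeroʳ (i ℚ./ 1))

constantℤ-morphism :
  CommutativeRing.rawRing ℤ.+-*-commutativeRing -Raw-AlmostCommutative⟶ fromCommutativeRing powerSeriesRing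
constantℤ-morphism = record
  { ⟦_⟧    = constantℤ
  ; +-homo = constantℤ-+
  ; *-homo = constantℤ-*
  ; -‿homo = constantℤ-neg
  ; 0-homo = λ { zero → refl ; (suc _) → refl }
  ; 1-homo = λ _ → refl
  }

coefficients≟ : ∀ i j → Maybe (constantℤ i ≈ constantℤ j)
coefficients≟ i j with i ℤ.≟ j
... | yes refl = just λ _ → refl
... | no  _    = nothing

open import Algebra.Solver.Ring _ _ constantℤ-morphism coefficients≟
  using (solve; con; _:+_; _:*_; _:-_; _:=_)

-- The Catalan series

choose*!*! : ∀ {n k} → k ℕ.≤ n → (n choose k) ℕ.* (k ! ℕ.* (n ∸ k) !) ≡ n !
choose*!*! {n} {k} k≤n =
  trans (cong (ℕ._* (k ! ℕ.* (n ∸ k) !)) (nCk≡n!/k![n-k]! k≤n))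
        (ℕ.m/n*n≡m {{k !* (n ∸ k) !≢0}} (k![n∸k]!∣n! k≤n))

central : ℕ → ℕ
central n = (2 ℕ.* n) choose n

central*!*! : ∀ n → central n ℕ.* (n ! ℕ.* n !) ≡ (2 ℕ.* n) !
central*!*! n =
  subst (λ m → central n ℕ.* (n ! ℕ.* m !) ≡ (2 ℕ.* n) !)
        (trans (ℕ.m+n∸m≡n n (n ℕ.+ 0)) (ℕ.+-identityʳ n))
        (choose*!*! (ℕ.m≤m+n n (n ℕ.+ 0)))

-- Multiplied by (n + 1) · n! · n!, both sides become (2n + 2)!.
central-suc : ∀ n → suc n ℕ.* central (suc n) ≡ (4 ℕ.* n ℕ.+ 2) ℕ.* central n
central-suc n = ℕ.*-cancelʳ-≡ _ _ (suc n ℕ.* (n ! ℕ.* n !)) {{ℕ.m*n≢0 (suc n) _ {{_}} {{n !* n !≢0}}}} (begin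
  suc n ℕ.* central (suc n) ℕ.* (suc n ℕ.* (n ! ℕ.* n !))
    ≡⟨ N.solve 3 (λ s b f → s N.:* b N.:* (s N.:* (f N.:* f)) N.:= b N.:* (s N.:* f N.:* (s N.:* f))) refl (suc n) (central (suc n)) (n !) ⟩
  central (suc n) ℕ.* (suc n ! ℕ.* suc n !)
    ≡⟨ central*!*! (suc n) ⟩
  (2 ℕ.* suc n) !
    ≡⟨ cong _! (ℕ.*-suc 2 n) ⟩
  suc (suc (2 ℕ.* n)) ℕ.* (suc (2 ℕ.* n) ℕ.* (2 ℕ.* n) !)
    ≡⟨ cong (λ u → suc (suc (2 ℕ.* n)) ℕ.* (suc (2 ℕ.* n) ℕ.* u)) (central*!*! n) ⟨
  suc (suc (2 ℕ.* n)) ℕ.* (suc (2 ℕ.* n) ℕ.* (central n ℕ.* (n ! ℕ.* n !)))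
    ≡⟨ N.solve 3 (λ m b g →
         (N.con 2 N.:+ N.con 2 N.:* m) N.:* ((N.con 1 N.:+ N.con 2 N.:* m) N.:* (b N.:* g))
         N.:= (N.con 4 N.:* m N.:+ N.con 2) N.:* b N.:* ((N.con 1 N.:+ m) N.:* g))
         refl n (central n) (n ! ℕ.* n !) ⟩
  (4 ℕ.* n ℕ.+ 2) ℕ.* central n ℕ.* (suc n ℕ.* (n ! ℕ.* n !))
    ∎)
  where
  open ≡-Reasoning
  module N = ℕ-Solver

*-cancelˡ-suc : ∀ m {p q} → fromℕ (suc m) ℚ.* p ≡ fromℕ (suc m) ℚ.* q → p ≡ q
*-cancelˡ-suc m {p} {q} eq = begin
  p                                                  ≡⟨ lemma p ⟨
  ℚ.1/ fromℕ (suc m) ℚ.* (fromℕ (suc m) ℚ.* p)       ≡⟨ cong (ℚ.1/ fromℕ (suc m) ℚ.*_) eq ⟩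
  ℚ.1/ fromℕ (suc m) ℚ.* (fromℕ (suc m) ℚ.* q)       ≡⟨ lemma q ⟩
  q                                                  ∎
  where
  open ≡-Reasoning
  instance
    _ = fromℕ-nonZero m
  lemma : ∀ r → ℚ.1/ fromℕ (suc m) ℚ.* (fromℕ (suc m) ℚ.* r) ≡ r
  lemma r = trans (sym (ℚ.*-assoc (ℚ.1/ fromℕ (suc m)) (fromℕ (suc m)) r))
    (trans (cong (ℚ._* r) (ℚ.*-inverseˡ (fromℕ (suc m)))) (ℚ.*-identityˡ r))

fromℕ-suc*/ : ∀ m k → fromℕ (suc m) ℚ.* (+ k ℚ./ suc m) ≡ fromℕ k
fromℕ-suc*/ m k = ℚ.toℚᵘ-injective (begin
  ℚ.toℚᵘ (fromℕ (suc m) ℚ.* (+ k ℚ./ suc m))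
    ≈⟨ ℚ.toℚᵘ-homo-* (fromℕ (suc m)) (+ k ℚ./ suc m) ⟩
  ℚ.toℚᵘ (fromℕ (suc m)) ℚᵘ.* ℚ.toℚᵘ (+ k ℚ./ suc m)
    ≈⟨ ℚᵘ.*-cong (ℚ.toℚᵘ-fromℚᵘ (mkℚᵘ (+ suc m) 0)) (ℚ.toℚᵘ-fromℚᵘ (mkℚᵘ (+ k) m)) ⟩
  mkℚᵘ (+ suc m) 0 ℚᵘ.* mkℚᵘ (+ k) m
    ≈⟨ *≡* (trans (ℤ.*-identityʳ _) (trans (ℤ.*-comm (+ suc m) (+ k)) (cong (+ k ℤ.*_) (cong (λ u → + suc u) (sym (ℕ.+-identityʳ m)))))) ⟩
  mkℚᵘ (+ k) 0
    ≈⟨ ℚ.toℚᵘ-fromℚᵘ (mkℚᵘ (+ k) 0) ⟨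
  ℚ.toℚᵘ (fromℕ k)
    ∎)
  where open ℚᵘ.≃-Reasoning

C-suc : ∀ n → fromℕ (2 ℕ.+ n) ℚ.* C (suc n) ≡ fromℕ (4 ℕ.* n ℕ.+ 2) ℚ.* C n
C-suc n = *-cancelˡ-suc n (begin
  fromℕ (suc n) ℚ.* (fromℕ (2 ℕ.+ n) ℚ.* C (suc n))
    ≡⟨ cong (fromℕ (suc n) ℚ.*_) (fromℕ-suc*/ (suc n) (central (suc n))) ⟩
  fromℕ (suc n) ℚ.* fromℕ (central (suc n))
    ≡⟨ fromℕ-* (suc n) (central (suc n)) ⟨
  fromℕ (suc n ℕ.* central (suc n))
    ≡⟨ cong fromℕ (central-suc n) ⟩
  fromℕ ((4 ℕ.* n ℕ.+ 2) ℕ.* central n)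
    ≡⟨ fromℕ-* (4 ℕ.* n ℕ.+ 2) (central n) ⟩
  fromℕ (4 ℕ.* n ℕ.+ 2) ℚ.* fromℕ (central n)
    ≡⟨ cong (fromℕ (4 ℕ.* n ℕ.+ 2) ℚ.*_) (fromℕ-suc*/ n (central n)) ⟨
  fromℕ (4 ℕ.* n ℕ.+ 2) ℚ.* (fromℕ (suc n) ℚ.* C n)
    ≡⟨ x∙yz≈y∙xz (fromℕ (4 ℕ.* n ℕ.+ 2)) (fromℕ (suc n)) (C n) ⟩
  fromℕ (suc n) ℚ.* (fromℕ (4 ℕ.* n ℕ.+ 2) ℚ.* C n)
    ∎)
  where
  open ≡-Reasoning

-- The Euler operator x d/dx.
θ : PowerSeries → PowerSeries
θ A n = fromℕ n ℚ.* A n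

-- The Leibniz rule: in the i-th summand the factor n splits as i + (n - i).
θ-* : ∀ A B → θ (A * B) ≈ θ A * B + A * θ B
θ-* A B n = begin
  fromℕ n ℚ.* (A * B) n
    ≡⟨ *-distribˡ-sum {suc n} (fromℕ n) (λ i → A (toℕ i) ℚ.* B (n ∸ toℕ i)) ⟩
  ∑[ i ≤ n ] (fromℕ n ℚ.* (A (toℕ i) ℚ.* B (n ∸ toℕ i)))
    ≡⟨ sum-cong-≗ {suc n} term ⟩
  ∑[ i ≤ n ] (θ A (toℕ i) ℚ.* B (n ∸ toℕ i) ℚ.+ A (toℕ i) ℚ.* θ B (n ∸ toℕ i))
    ≡⟨ ∑-distrib-+ {suc n} (λ i → θ A (toℕ i) ℚ.* B (n ∸ toℕ i)) (λ i → A (toℕ i) ℚ.* θ B (n ∸ toℕ i)) ⟩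
  (θ A * B) n ℚ.+ (A * θ B) n
    ∎
  where
  open ≡-Reasoning
  term : ∀ (i : Fin (suc n)) → fromℕ n ℚ.* (A (toℕ i) ℚ.* B (n ∸ toℕ i))
       ≡ θ A (toℕ i) ℚ.* B (n ∸ toℕ i) ℚ.+ A (toℕ i) ℚ.* θ B (n ∸ toℕ i)
  term i = begin
    fromℕ n ℚ.* (a ℚ.* b)
      ≡⟨ cong (λ m → fromℕ m ℚ.* (a ℚ.* b)) (ℕ.m+[n∸m]≡n (Fin.toℕ≤pred[n] i)) ⟨
    fromℕ (toℕ i ℕ.+ (n ∸ toℕ i)) ℚ.* (a ℚ.* b)
      ≡⟨ cong (ℚ._* (a ℚ.* b)) (fromℕ-+ (toℕ i) (n ∸ toℕ i)) ⟩
    (fromℕ (toℕ i) ℚ.+ fromℕ (n ∸ toℕ i)) ℚ.* (a ℚ.* b)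
      ≡⟨ ℚ.*-distribʳ-+ (a ℚ.* b) (fromℕ (toℕ i)) (fromℕ (n ∸ toℕ i)) ⟩
    fromℕ (toℕ i) ℚ.* (a ℚ.* b) ℚ.+ fromℕ (n ∸ toℕ i) ℚ.* (a ℚ.* b)
      ≡⟨ cong₂ ℚ._+_ (sym (ℚ.*-assoc (fromℕ (toℕ i)) a b)) (x∙yz≈y∙xz (fromℕ (n ∸ toℕ i)) a b) ⟩
    fromℕ (toℕ i) ℚ.* a ℚ.* b ℚ.+ a ℚ.* (fromℕ (n ∸ toℕ i) ℚ.* b)
      ∎
    where
    a b : ℚ
    a = A (toℕ i)
    b = B (n ∸ toℕ i)

-- The recurrence `C-suc` as a differential equation: `θ C + C` has the coefficients (n + 1) C n.
θC : θ C + C ≈ constant 1 + x * (constant 4 * θ C + constant 2 * C)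
θC zero    = refl
θC (suc n) = begin
  fromℕ (suc n) ℚ.* C (suc n) ℚ.+ C (suc n)
    ≡⟨ cong (fromℕ (suc n) ℚ.* C (suc n) ℚ.+_) (ℚ.*-identityˡ (C (suc n))) ⟨
  fromℕ (suc n) ℚ.* C (suc n) ℚ.+ 1ℚ ℚ.* C (suc n)
    ≡⟨ ℚ.*-distribʳ-+ (C (suc n)) (fromℕ (suc n)) 1ℚ ⟨
  (fromℕ (suc n) ℚ.+ 1ℚ) ℚ.* C (suc n)
    ≡⟨ cong (ℚ._* C (suc n)) (trans (sym (fromℕ-+ (suc n) 1)) (cong fromℕ (ℕ.+-comm (suc n) 1))) ⟩
  fromℕ (2 ℕ.+ n) ℚ.* C (suc n)
    ≡⟨ C-suc n ⟩
  fromℕ (4 ℕ.* n ℕ.+ 2) ℚ.* C n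
    ≡⟨ cong (ℚ._* C n) (trans (fromℕ-+ (4 ℕ.* n) 2) (cong (ℚ._+ fromℕ 2) (fromℕ-* 4 n))) ⟩
  (fromℕ 4 ℚ.* fromℕ n ℚ.+ fromℕ 2) ℚ.* C n
    ≡⟨ ℚ.*-distribʳ-+ (C n) (fromℕ 4 ℚ.* fromℕ n) (fromℕ 2) ⟩
  fromℕ 4 ℚ.* fromℕ n ℚ.* C n ℚ.+ fromℕ 2 ℚ.* C n
    ≡⟨ cong (ℚ._+ fromℕ 2 ℚ.* C n) (ℚ.*-assoc (fromℕ 4) (fromℕ n) (C n)) ⟩
  fromℕ 4 ℚ.* θ C n ℚ.+ fromℕ 2 ℚ.* C n
    ≡⟨ cong₂ ℚ._+_ (constant-* 4 (θ C) n) (constant-* 2 C n) ⟨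
  (constant 4 * θ C + constant 2 * C) n
    ≡⟨ trans (ℚ.+-identityˡ _) (x-*-suc (constant 4 * θ C + constant 2 * C) n) ⟨
  (constant 1 + x * (constant 4 * θ C + constant 2 * C)) (suc n)
    ∎
  where open ≡-Reasoning

-- 2C times θC, rewritten with the Leibniz rule.  Together with C-suc it yields the
-- same first-order recurrence for the coefficients of C² as for those of (C - 1) / x.
θ[C*C] : θ (C * C) + constant 2 * (C * C) ≈ constant 2 * C + x * (constant 4 * θ (C * C) + constant 4 * (C * C))
θ[C*C] = begin
  θ (C * C) + constant 2 * (C * C)
    ≈⟨ +-congʳ (θ-* C C) ⟩
  θ C * C + C * θ C + constant 2 * (C * C)
    ≈⟨ solve 2 (λ t c → t :* c :+ c :* t :+ con (+ 2) :* (c :* c) := con (+ 2) :* c :* (t :+ c)) ≈-refl (θ C) C ⟩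
  constant 2 * C * (θ C + C)
    ≈⟨ *-congˡ {constant 2 * C} θC ⟩
  constant 2 * C * (constant 1 + x * (constant 4 * θ C + constant 2 * C))
    ≈⟨ solve 3 (λ z t c → con (+ 2) :* c :* (con (+ 1) :+ z :* (con (+ 4) :* t :+ con (+ 2) :* c))
                  := con (+ 2) :* c :+ z :* (con (+ 4) :* (t :* c :+ c :* t) :+ con (+ 4) :* (c :* c))) ≈-refl x (θ C) C ⟩
  constant 2 * C + x * (constant 4 * (θ C * C + C * θ C) + constant 4 * (C * C))
    ≈⟨ +-congˡ {constant 2 * C} (*-congˡ {x} (+-congʳ (*-congˡ {constant 4} (θ-* C C)))) ⟨
  constant 2 * C + x * (constant 4 * θ (C * C) + constant 4 * (C * C))
    ∎
  where open import Relation.Binary.Reasoning.Setoid setoid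

-- By the induction hypothesis the term 2 C of `θ[C*C]` merges with the rest into (4 (n + 1) + 2) C
-- (n + 1), the right side of `C-suc`.
C*C : ∀ n → (C * C) n ≡ C (suc n)
C*C zero    = refl
C*C (suc n) = *-cancelˡ-suc (2 ℕ.+ n) (begin
  fromℕ (3 ℕ.+ n) ℚ.* y′
    ≡⟨ cong (ℚ._* y′) (trans (cong fromℕ (ℕ.+-comm 2 (suc n))) (fromℕ-+ (suc n) 2)) ⟩
  (fromℕ (suc n) ℚ.+ fromℕ 2) ℚ.* y′
    ≡⟨ ℚ.*-distribʳ-+ y′ (fromℕ (suc n)) (fromℕ 2) ⟩
  fromℕ (suc n) ℚ.* y′ ℚ.+ fromℕ 2 ℚ.* y′
    ≡⟨ cong (fromℕ (suc n) ℚ.* y′ ℚ.+_) (constant-* 2 (C * C) (suc n)) ⟨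
  (θ (C * C) + constant 2 * (C * C)) (suc n)
    ≡⟨ θ[C*C] (suc n) ⟩
  (constant 2 * C) (suc n) ℚ.+ (x * (constant 4 * θ (C * C) + constant 4 * (C * C))) (suc n)
    ≡⟨ cong₂ ℚ._+_ (constant-* 2 C (suc n)) (x-*-suc (constant 4 * θ (C * C) + constant 4 * (C * C)) n) ⟩
  fromℕ 2 ℚ.* C (suc n) ℚ.+ ((constant 4 * θ (C * C)) n ℚ.+ (constant 4 * (C * C)) n)
    ≡⟨ cong (fromℕ 2 ℚ.* C (suc n) ℚ.+_) (cong₂ ℚ._+_ (constant-* 4 (θ (C * C)) n) (constant-* 4 (C * C) n)) ⟩
  fromℕ 2 ℚ.* C (suc n) ℚ.+ (fromℕ 4 ℚ.* (fromℕ n ℚ.* (C * C) n) ℚ.+ fromℕ 4 ℚ.* (C * C) n)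
    ≡⟨ cong (λ u → fromℕ 2 ℚ.* C (suc n) ℚ.+ (fromℕ 4 ℚ.* (fromℕ n ℚ.* u) ℚ.+ fromℕ 4 ℚ.* u)) (C*C n) ⟩
  fromℕ 2 ℚ.* c ℚ.+ (fromℕ 4 ℚ.* (fromℕ n ℚ.* c) ℚ.+ fromℕ 4 ℚ.* c)
    ≡⟨ Q.solve 2 (λ m c → Q.con (fromℕ 2) Q.:* c Q.:+ (Q.con (fromℕ 4) Q.:* (m Q.:* c) Q.:+ Q.con (fromℕ 4) Q.:* c)
          Q.:= (Q.con (fromℕ 4) Q.:* (Q.con 1ℚ Q.:+ m) Q.:+ Q.con (fromℕ 2)) Q.:* c) refl (fromℕ n) c ⟩
  (fromℕ 4 ℚ.* (1ℚ ℚ.+ fromℕ n) ℚ.+ fromℕ 2) ℚ.* c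
    ≡⟨ cong (λ u → (fromℕ 4 ℚ.* u ℚ.+ fromℕ 2) ℚ.* c) (fromℕ-+ 1 n) ⟨
  (fromℕ 4 ℚ.* fromℕ (suc n) ℚ.+ fromℕ 2) ℚ.* c
    ≡⟨ cong (ℚ._* c) (trans (fromℕ-+ (4 ℕ.* suc n) 2) (cong (ℚ._+ fromℕ 2) (fromℕ-* 4 (suc n)))) ⟨
  fromℕ (4 ℕ.* suc n ℕ.+ 2) ℚ.* c
    ≡⟨ C-suc (suc n) ⟨
  fromℕ (3 ℕ.+ n) ℚ.* C (2 ℕ.+ n)
    ∎)
  where
  open ≡-Reasoning
  module Q = ℚ-Solver
  y′ c : ℚ
  y′ = (C * C) (suc n)
  c  = C (suc n)

C-quadratic : C ≈ constant 1 + x * (C * C)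
C-quadratic zero    = refl
C-quadratic (suc n) = sym (trans (ℚ.+-identityˡ _) (trans (x-*-suc (C * C) n) (C*C n)))

-- Solving the tree recurrences

denominator : PowerSeries
denominator = constant 2 - constant 2 * x - (constant 1 - x - x * x) * C

-- `F′` is the claimed value of F. The rule of J(0, 1), whose children are J(0, 2) and J(1, 1),
-- forces (1 - x C) Q = 1 + (1 - x) E = 1 + (C - 1) F, and 1 / (1 - x C) = C yields `Q`.
G F′ Q E : PowerSeries
G = inverse denominator
F′ = (constant 1 - x) * G
Q = C * (constant 1 + (C - constant 1) * F′)
E = (C - constant 1) * G

seriesK : ℕ → PowerSeries
seriesK a = C ^ (2 ℕ.+ a) * F′

seriesJ : ℕ → ℕ → PowerSeries
seriesJ c b = C ^ (suc b) * Q + (constant c - constant 1) * E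

sumDownSeries : (ℕ → PowerSeries) → ℕ → PowerSeries
sumDownSeries f zero    = constant 0
sumDownSeries f (suc n) = f n + sumDownSeries f n

quadratic-vanishes : constant 1 + x * (C * C) - C ≈ constant 0
quadratic-vanishes = ≈-trans (+-congʳ { - C} (≈-sym C-quadratic))
  (solve 1 (λ c → c :- c := con (+ 0)) ≈-refl C)

denominator-vanishes : denominator * G - constant 1 ≈ constant 0
denominator-vanishes = ≈-trans (+-congʳ { - constant 1} (*-inverseʳ denominator))
  (solve 0 (con (+ 1) :- con (+ 1) := con (+ 0)) ≈-refl)

-- Lets the solver work modulo a relation: an explicit multiple of a vanishing series makes an
-- identity polynomial and is removed afterwards.
drop-zero : ∀ A B {r} → r ≈ constant 0 → A + B * r ≈ A
drop-zero A B {r} r≈0 = begin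
  A + B * r           ≈⟨ +-congˡ {A} (*-congˡ {B} r≈0) ⟩
  A + B * constant 0  ≈⟨ solve 2 (λ a b → a :+ b :* con (+ 0) := a) ≈-refl A B ⟩
  A                   ∎
  where open import Relation.Binary.Reasoning.Setoid setoid

constant-suc : ∀ n → constant (suc n) ≈ constant 1 + constant n
constant-suc n = constantℤ-+ (+ 1) (+ n)

-- Telescopes, since x C^(i+2) = C^(i+1) - C^i.
x*∑seriesK : ∀ n → x * sumDownSeries seriesK n ≈ (C ^ n - constant 1) * F′
x*∑seriesK zero = solve 2 (λ z f → z :* con (+ 0) := (con (+ 1) :- con (+ 1)) :* f) ≈-refl x F′
x*∑seriesK (suc n) = begin
  x * (C ^ (2 ℕ.+ n) * F′ + sumDownSeries seriesK n)
    ≈⟨ solve 3 (λ z p s → z :* (p :+ s) := z :* p :+ z :* s) ≈-refl x (C ^ (2 ℕ.+ n) * F′) (sumDownSeries seriesK n) ⟩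
  x * (C ^ (2 ℕ.+ n) * F′) + x * sumDownSeries seriesK n
    ≈⟨ +-congˡ {x * (C ^ (2 ℕ.+ n) * F′)} (x*∑seriesK n) ⟩
  x * (C ^ (2 ℕ.+ n) * F′) + (C ^ n - constant 1) * F′
    ≈⟨ solve 4 (λ z c p f → z :* (c :* (c :* p) :* f) :+ (p :- con (+ 1)) :* f
         := (c :* p :- con (+ 1)) :* f :+ (p :* f) :* (con (+ 1) :+ z :* (c :* c) :- c)) ≈-refl x C (C ^ n) F′ ⟩
  (C ^ suc n - constant 1) * F′ + C ^ n * F′ * (constant 1 + x * (C * C) - C)
    ≈⟨ drop-zero ((C ^ suc n - constant 1) * F′) (C ^ n * F′) quadratic-vanishes ⟩
  (C ^ suc n - constant 1) * F′
    ∎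
  where open import Relation.Binary.Reasoning.Setoid setoid

-- The part with `Q` telescopes likewise, and each of the n summands contributes a further -E.
x*∑seriesJ : ∀ n → x * sumDownSeries (seriesJ 0 ∘ suc) n ≈ (C ^ n - constant 1) * Q - constant n * (x * E)
x*∑seriesJ zero = solve 3 (λ z q e → z :* con (+ 0) := (con (+ 1) :- con (+ 1)) :* q :- con (+ 0) :* (z :* e)) ≈-refl x Q E
x*∑seriesJ (suc n) = begin
  x * (seriesJ 0 (suc n) + ∑J)
    ≈⟨ solve 3 (λ z p s → z :* (p :+ s) := z :* p :+ z :* s) ≈-refl x (seriesJ 0 (suc n)) ∑J ⟩
  x * seriesJ 0 (suc n) + x * ∑J
    ≈⟨ +-congˡ {x * seriesJ 0 (suc n)} (x*∑seriesJ n) ⟩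
  x * seriesJ 0 (suc n) + ((C ^ n - constant 1) * Q - constant n * (x * E))
    ≈⟨ solve 6 (λ z c p q e k → z :* (c :* (c :* p) :* q :+ (con (+ 0) :- con (+ 1)) :* e) :+ ((p :- con (+ 1)) :* q :- k :* (z :* e))
         := (c :* p :- con (+ 1)) :* q :- (con (+ 1) :+ k) :* (z :* e) :+ (p :* q) :* (con (+ 1) :+ z :* (c :* c) :- c))
         ≈-refl x C (C ^ n) Q E (constant n) ⟩
  (C ^ suc n - constant 1) * Q - (constant 1 + constant n) * (x * E) + C ^ n * Q * (constant 1 + x * (C * C) - C)
    ≈⟨ drop-zero ((C ^ suc n - constant 1) * Q - (constant 1 + constant n) * (x * E)) (C ^ n * Q) quadratic-vanishes ⟩
  (C ^ suc n - constant 1) * Q - (constant 1 + constant n) * (x * E)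
    ≈⟨ +-congˡ {(C ^ suc n - constant 1) * Q} (-‿cong (*-congʳ {x * E} (constant-suc n))) ⟨
  (C ^ suc n - constant 1) * Q - constant (suc n) * (x * E)
    ∎
  where
  open import Relation.Binary.Reasoning.Setoid setoid
  ∑J : PowerSeries
  ∑J = sumDownSeries (seriesJ 0 ∘ suc) n

-- The equation that determines the denominator. Replacing x C² by C - 1 in x C² W, for W = Q / C,
-- and cancelling (x + x² C² - x C) G leaves C times `denominator * G - constant 1`.
F′-equation : F′ ≈ constant 1 + x * seriesJ 0 0
F′-equation = begin
  F′
    ≈⟨ solve 3 (λ z c g →
         -- `F′`, Q / C and `denominator` are spelled out, so that x, C and G are the only atoms.
         let one = con (+ 1)
             f = (one :- z) :* g
             w = one :+ (c :- one) :* f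
             d = con (+ 2) :- con (+ 2) :* z :- (one :- z :- z :* z) :* c
         in f := one :+ z :* (c :* one :* (c :* w) :+ (con (+ 0) :- one) :* ((c :- one) :* g))
              :+ c :* (d :* g :- one) :+ (con (+ 0) :- (z :* g :+ w)) :* (one :+ z :* (c :* c) :- c))
         ≈-refl x C G ⟩
  constant 1 + x * seriesJ 0 0 + C * (denominator * G - constant 1)
    + (constant 0 - (x * G + (constant 1 + (C - constant 1) * F′))) * (constant 1 + x * (C * C) - C)
    ≈⟨ drop-zero (constant 1 + x * seriesJ 0 0 + C * (denominator * G - constant 1)) (constant 0 - (x * G + (constant 1 + (C - constant 1) * F′))) quadratic-vanishes ⟩
  constant 1 + x * seriesJ 0 0 + C * (denominator * G - constant 1)
    ≈⟨ drop-zero (constant 1 + x * seriesJ 0 0) C denominator-vanishes ⟩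
  constant 1 + x * seriesJ 0 0
    ∎
  where open import Relation.Binary.Reasoning.Setoid setoid

childrenK : ℕ → PowerSeries
childrenK a = sumDownSeries seriesK (2 ℕ.+ a) + seriesJ 0 0

childrenJ : ℕ → ℕ → PowerSeries
childrenJ c b = constant c * seriesK 0 + (seriesJ c (suc b) + (sumDownSeries (seriesJ 0 ∘ suc) b + seriesJ (suc b) 0))

-- By `F′-equation` the node itself and its child J(0, 1) together contribute `F′`; the children K
-- telescope.
seriesK-equation : ∀ a → seriesK a ≈ constant 1 + x * childrenK a
seriesK-equation a = begin
  C ^ (2 ℕ.+ a) * F′
    ≈⟨ solve 2 (λ p f → p :* f := f :+ (p :- con (+ 1)) :* f) ≈-refl (C ^ (2 ℕ.+ a)) F′ ⟩
  F′ + (C ^ (2 ℕ.+ a) - constant 1) * F′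
    ≈⟨ +-cong F′-equation (≈-sym (x*∑seriesK (2 ℕ.+ a))) ⟩
  constant 1 + x * seriesJ 0 0 + x * sumDownSeries seriesK (2 ℕ.+ a)
    ≈⟨ solve 3 (λ z j s → con (+ 1) :+ z :* j :+ z :* s := con (+ 1) :+ z :* (s :+ j)) ≈-refl x (seriesJ 0 0) (sumDownSeries seriesK (2 ℕ.+ a)) ⟩
  constant 1 + x * childrenK a
    ∎
  where open import Relation.Binary.Reasoning.Setoid setoid

-- A factor x C² arises from the c children K(1), from J(c, b + 2) and from J(b + 1, 1), with
-- cofactors c F′, C^b Q and W = Q / C. Once it is replaced by C - 1, what remains is (C - 1) F′ =
-- (1 - x) E.
seriesJ-equation : ∀ c b → seriesJ c b ≈ constant 1 + x * childrenJ c b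
seriesJ-equation c b = begin
  seriesJ c b
    ≈⟨ solve 6 (λ z c g p k n →
         let one = con (+ 1)
             f = (one :- z) :* g
             w = one :+ (c :- one) :* f
             q = c :* w
             e = (c :- one) :* g
         in c :* p :* q :+ (k :- one) :* e
            := one :+ z :* (k :* (c :* (c :* one) :* f) :+ (c :* (c :* p) :* q :+ (k :- one) :* e
                 :+ (c :* one :* q :+ ((one :+ n) :- one) :* e)))
               :+ ((p :- one) :* q :- n :* (z :* e))
               :+ (con (+ 0) :- (w :+ k :* f :+ p :* q)) :* (one :+ z :* (c :* c) :- c))
         ≈-refl x C G (C ^ b) (constant c) (constant b) ⟩
  constant 1 + x * (constant c * seriesK 0 + (seriesJ c (suc b) + (C ^ 1 * Q + (constant 1 + constant b - constant 1) * E)))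
    + ((C ^ b - constant 1) * Q - constant b * (x * E))
    + (constant 0 - (W + constant c * F′ + C ^ b * Q)) * (constant 1 + x * (C * C) - C)
    ≈⟨ drop-zero _ (constant 0 - (W + constant c * F′ + C ^ b * Q)) quadratic-vanishes ⟩
  constant 1 + x * (constant c * seriesK 0 + (seriesJ c (suc b) + (C ^ 1 * Q + (constant 1 + constant b - constant 1) * E)))
    + ((C ^ b - constant 1) * Q - constant b * (x * E))
    ≈⟨ +-cong
         (+-congˡ {constant 1} (*-congˡ {x} (+-congˡ {constant c * seriesK 0} (+-congˡ {seriesJ c (suc b)} (+-congˡ {C ^ 1 * Q} (*-congʳ {E} (+-congʳ { - constant 1} (constant-suc b))))))))
         (x*∑seriesJ b) ⟨
  constant 1 + x * (constant c * seriesK 0 + (seriesJ c (suc b) + seriesJ (suc b) 0)) + x * ∑J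
    ≈⟨ solve 5 (λ z k j s j′ → con (+ 1) :+ z :* (k :+ (j :+ j′)) :+ z :* s := con (+ 1) :+ z :* (k :+ (j :+ (s :+ j′))))
         ≈-refl x (constant c * seriesK 0) (seriesJ c (suc b)) ∑J (seriesJ (suc b) 0) ⟩
  constant 1 + x * childrenJ c b
    ∎
  where
  open import Relation.Binary.Reasoning.Setoid setoid
  W ∑J : PowerSeries
  W = constant 1 + (C - constant 1) * F′
  ∑J = sumDownSeries (seriesJ 0 ∘ suc) b

coefficient-zero : ∀ A B → A ≈ constant 1 + x * B → A 0 ≡ 1ℚ
coefficient-zero A B eq = trans (eq 0) (cong (1ℚ ℚ.+_) (x-*-zero B))

coefficient-suc : ∀ A B → A ≈ constant 1 + x * B → ∀ n → A (suc n) ≡ B n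
coefficient-suc A B eq n = trans (eq (suc n)) (trans (ℚ.+-identityˡ _) (x-*-suc B n))

fromℕ-sumDown : ∀ f g m → (∀ k → fromℕ (f k) ≡ g k m) → ∀ n → fromℕ (sumDown f n) ≡ sumDownSeries g n m
-- `constant 0` vanishes in every degree but reduces only when the degree is a constructor.
fromℕ-sumDown f g m f≡g zero with m
... | zero  = refl
... | suc _ = refl
fromℕ-sumDown f g m f≡g (suc n) =
  trans (fromℕ-+ (f n) (sumDown f n)) (cong₂ ℚ._+_ (f≡g n) (fromℕ-sumDown f g m f≡g n))

-- Uniqueness of the solution: induction on the degree, for all labels at once, because the children
-- of a node carry unbounded labels but enter one degree lower.
nodesK≡ : ∀ m a → fromℕ (nodesK m a) ≡ seriesK a m
nodesJ≡ : ∀ m c b → fromℕ (nodesJ m c b) ≡ seriesJ c b m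
nodesK≡ zero a = sym (coefficient-zero (seriesK a) (childrenK a) (seriesK-equation a))
nodesK≡ (suc m) a = begin
  fromℕ (sumDown (nodesK m) (2 ℕ.+ a) ℕ.+ nodesJ m 0 0)
    ≡⟨ fromℕ-+ (sumDown (nodesK m) (2 ℕ.+ a)) (nodesJ m 0 0) ⟩
  fromℕ (sumDown (nodesK m) (2 ℕ.+ a)) ℚ.+ fromℕ (nodesJ m 0 0)
    ≡⟨ cong₂ ℚ._+_ (fromℕ-sumDown (nodesK m) seriesK m (nodesK≡ m) (2 ℕ.+ a)) (nodesJ≡ m 0 0) ⟩
  childrenK a m
    ≡⟨ coefficient-suc (seriesK a) (childrenK a) (seriesK-equation a) m ⟨
  seriesK a (suc m)
    ∎
  where open ≡-Reasoning
nodesJ≡ zero c b = sym (coefficient-zero (seriesJ c b) (childrenJ c b) (seriesJ-equation c b))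
nodesJ≡ (suc m) c b = begin
  fromℕ (c ℕ.* nodesK m 0 ℕ.+ (nodesJ m c (suc b) ℕ.+ (s ℕ.+ nodesJ m (suc b) 0)))
    ≡⟨ fromℕ-+ (c ℕ.* nodesK m 0) _ ⟩
  fromℕ (c ℕ.* nodesK m 0) ℚ.+ fromℕ (nodesJ m c (suc b) ℕ.+ (s ℕ.+ nodesJ m (suc b) 0))
    ≡⟨ cong₂ ℚ._+_ (trans (fromℕ-* c (nodesK m 0)) (trans (cong (fromℕ c ℚ.*_) (nodesK≡ m 0)) (sym (constant-* c (seriesK 0) m))))
         (trans (fromℕ-+ (nodesJ m c (suc b)) _) (cong₂ ℚ._+_ (nodesJ≡ m c (suc b))
           (trans (fromℕ-+ s _) (cong₂ ℚ._+_ (fromℕ-sumDown (nodesJ m 0 ∘ suc) (seriesJ 0 ∘ suc) m (λ k → nodesJ≡ m 0 (suc k)) b) (nodesJ≡ m (suc b) 0))))) ⟩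
  childrenJ c b m
    ≡⟨ coefficient-suc (seriesJ c b) (childrenJ c b) (seriesJ-equation c b) m ⟨
  seriesJ c b (suc m)
    ∎
  where
  open ≡-Reasoning
  s : ℕ
  s = sumDown (nodesJ m 0 ∘ suc) b

theorem32 : let T = (1 ∷ 3 ∷ 2 ∷ 4 ∷ []) ∷ (1 ∷ 4 ∷ 3 ∷ 2 ∷ []) ∷ (3 ∷ 1 ∷ 4 ∷ 2 ∷ []) ∷ [] in
    F T ≈ (constant 1 - x) / (constant 2 - constant 2 * x - (constant 1 - x - x * x) * C)
-- The empty permutation, which lies outside the tree, is the summand 1 of `F′-equation`.
theorem32 zero    = sym (coefficient-zero F′ (seriesJ 0 0) F′-equation)
theorem32 (suc n) = begin
  fromℕ (length (S (suc n) T))   ≡⟨ cong fromℕ (length-S≡nodesJ n) ⟩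
  fromℕ (nodesJ n 0 0)           ≡⟨ nodesJ≡ n 0 0 ⟩
  seriesJ 0 0 n                  ≡⟨ coefficient-suc F′ (seriesJ 0 0) F′-equation n ⟨
  F′ (suc n)                     ∎
  where open ≡-Reasoning
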